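{- Let $m_1,\dots,m_k$ be square-free positive integers and $p_1,\dots,p_t$ all the prime divisors of $m_1\cdots m_k$. Assume $N\varepsilon_{m_i}=-1$ for each $i$, and that $m_1\cdots m_k$ is a perfect square. Then $\varepsilon_{m_1}\cdots\varepsilon_{m_k}$ is a square in $\mathbb{Q}(\sqrt{p_1},\dots,\sqrt{p_t})$.
   Context: For a square-free integer $m>1$, $\varepsilon_m$ denotes the positive (as a real number, with $\sqrt m>0$) fundamental unit of $\mathbb{Q}(\sqrt m)$, and $N\varepsilon_m$ its norm to $\mathbb{Q}$; all these fields are regarded as subfields of $\mathbb{R}$. -}

module Defs where

open import Data.Nat as ℕ using (ℕ)
open import Data.Nat.Divisibility using (_∣_; _∣?_)
open import Data.Integer as ℤ using (ℤ; +_)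
open import Data.Rational as ℚ using (ℚ; 0ℚ; 1ℚ; _/_)
open import Data.Product using (_×_; _,_; ∃; ∃-syntax)
open import Data.Sum using (_⊎_)
open import Data.List using (List; []; _∷_)
open import Data.Fin using (Fin; zero; suc)
open import Data.Bool using (if_then_else_)
open import Relation.Nullary.Decidable using (⌊_⌋)
open import Relation.Binary.PropositionalEquality using (_≡_)

ℕ→ℚ : ℕ → ℚ
ℕ→ℚ n = (+ n) / 1

ℤ→ℚ : ℤ → ℚ
ℤ→ℚ z = z / 1

SquareFree : ℕ → Set
SquareFree n = ∀ d → (d ℕ.* d) ∣ n → d ≡ 1

-- The quadratic field ℚ(√m), m > 1 square-free: x = a + b√m ↦ (a , b)

QF : Set
QF = ℚ × ℚ

module _ (m : ℕ) where

  qmul : QF → QF → QF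
  qmul (a , b) (c , d) = (a ℚ.* c ℚ.+ ℕ→ℚ m ℚ.* (b ℚ.* d) , a ℚ.* d ℚ.+ b ℚ.* c)

  qone : QF
  qone = (1ℚ , 0ℚ)

  qneg : QF → QF
  qneg (a , b) = (ℚ.- a , ℚ.- b)

  qpow : QF → ℕ → QF
  qpow x ℕ.zero = qone
  qpow x (ℕ.suc n) = qmul x (qpow x n)

  qnorm : QF → ℚ
  qnorm (a , b) = a ℚ.* a ℚ.- ℕ→ℚ m ℚ.* (b ℚ.* b)

  qtrace : QF → ℚ
  qtrace (a , b) = a ℚ.+ a

  IsIntegerℚ : ℚ → Set
  IsIntegerℚ q = ∃[ z ] q ≡ ℤ→ℚ z

  -- algebraic integer of ℚ(√m): its characteristic polynomial
  -- X² - Tr(x) X + N(x) has integer coefficients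
  IsAlgInt : QF → Set
  IsAlgInt x = IsIntegerℚ (qtrace x) × IsIntegerℚ (qnorm x)

  IsUnit : QF → Set
  IsUnit x = IsAlgInt x × ∃[ y ] (IsAlgInt y × qmul x y ≡ qone)

  -- a + b√m > 0 as a real number (with √m > 0)
  IsPos : QF → Set
  IsPos (a , b) =
      (0ℚ ℚ.≤ a × 0ℚ ℚ.≤ b × (0ℚ ℚ.< a ⊎ 0ℚ ℚ.< b))
    ⊎ (0ℚ ℚ.< a × b ℚ.< 0ℚ × ℕ→ℚ m ℚ.* (b ℚ.* b) ℚ.< a ℚ.* a)
    ⊎ (a ℚ.< 0ℚ × 0ℚ ℚ.< b × a ℚ.* a ℚ.< ℕ→ℚ m ℚ.* (b ℚ.* b))

  IsGtOne : QF → Set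
  IsGtOne (a , b) = IsPos (a ℚ.- 1ℚ , b)

  IsFundamentalUnit : QF → Set
  IsFundamentalUnit ε =
    IsUnit ε × IsGtOne ε ×
    (∀ u → IsUnit u → ∃[ n ]
        ( u ≡ qpow ε n ⊎ u ≡ qneg (qpow ε n)
        ⊎ qmul u (qpow ε n) ≡ qone ⊎ qmul u (qneg (qpow ε n)) ≡ qone))

-- The multiquadratic field ℚ(√p₁, …, √pₜ) for a list ps = p₁ ∷ … ∷ pₜ
-- of distinct primes, built as a tower: ℚ(√p ∷ ps) = ℚ(√ps)(√p),
-- an element (a , b) standing for a + b√p with a, b ∈ ℚ(√ps).

MQ : List ℕ → Set
MQ [] = ℚ
MQ (p ∷ ps) = MQ ps × MQ ps

mconst : ∀ ps → ℚ → MQ ps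
mconst [] q = q
mconst (p ∷ ps) q = (mconst ps q , mconst ps 0ℚ)

madd : ∀ ps → MQ ps → MQ ps → MQ ps
madd [] x y = x ℚ.+ y
madd (p ∷ ps) (a , b) (c , d) = (madd ps a c , madd ps b d)

mmul : ∀ ps → MQ ps → MQ ps → MQ ps
mmul [] x y = x ℚ.* y
mmul (p ∷ ps) (a , b) (c , d) =
  ( madd ps (mmul ps a c) (mmul ps (mconst ps (ℕ→ℚ p)) (mmul ps b d))
  , madd ps (mmul ps a d) (mmul ps b c) )

-- √m := ∏_{p ∈ ps, p ∣ m} √p  (equals √m when m is square-free and all
-- prime divisors of m are in ps)
msqrt : ∀ ps → ℕ → MQ ps
msqrt [] m = 1ℚ
msqrt (p ∷ ps) m =
  if ⌊ p ∣? m ⌋ then (mconst ps 0ℚ , msqrt ps m) else (msqrt ps m , mconst ps 0ℚ)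

embed : ∀ ps → ℕ → QF → MQ ps
embed ps m (a , b) = madd ps (mconst ps a) (mmul ps (mconst ps b) (msqrt ps m))

prodℕ : ∀ k → (Fin k → ℕ) → ℕ
prodℕ ℕ.zero f = 1
prodℕ (ℕ.suc k) f = f zero ℕ.* prodℕ k (λ i → f (suc i))

mprod : ∀ ps k → (Fin k → MQ ps) → MQ ps
mprod ps ℕ.zero f = mconst ps 1ℚ
mprod ps (ℕ.suc k) f = mmul ps (f zero) (mprod ps k (λ i → f (suc i)))

{-# OPTIONS --safe #-}
module Submission where

-- For a unit ε = a + b√m of norm -1 one has (ε + i)² = 2ε(a + i) and (ε + i)(ε - i) = 2bε√m.
-- Here 2a + 2i is, up to content, a primitive Gaussian integer of norm m(2b)², so it equals
-- (c + di)w² with c² + d² = m and w w̄ = 2b.  Hence q = (ε + i)/w satisfies q² = ε(c + di) and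
-- q q̄ = ε√m.  Multiplying over all the mⱼ gives, in ℚ(√p₁,…,√pₜ)(i), an element Q = E + Fi with
-- Q² = X(U + Vi) and Q Q̄ = X r, where X = ∏ εⱼ, r = ∏ √mⱼ is a positive integer and U² + V² = r².
-- So 2E² = X(r + U) and 2F² = X(r - U).  Since (r + U)(r - U) = V², a positive one of these
-- factors is a square times gcd(r + U, r - U), which divides 2r; twice it is therefore a square
-- in ℚ(√p₁,…,√pₜ), where for 2 ∉ {pⱼ} one uses that V is even.

open import Defs
open import Algebra.Bundles using (CommutativeRing)
import Algebra.Solver.Ring as RingSolver
open import Algebra.Solver.Ring.AlmostCommutativeRing
import Algebra.Solver.Ring.NaturalCoefficients.Default as SemiringSolver
import Algebra.Solver.Ring.Simple as SimpleSolver
open import Algebra.Structures using (IsCommutativeRing)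
open import Data.Bool using (Bool; true; false; if_then_else_; _∧_; _xor_)
open import Data.Bool.Properties using (∧-idem; xor-same)
open import Data.Fin using (Fin; zero; suc)
open import Data.Integer as ℤ using (ℤ; +_; -[1+_]; +[1+_]; 0ℤ; 1ℤ; -1ℤ; ∣_∣)
open import Data.Integer.DivMod using (_%ℕ_; _/ℕ_; n%ℕd<d; a≡a%ℕn+[a/ℕn]*n)
import Data.Integer.Properties as ℤ
import Data.Integer.Solver as ℤ
open import Data.List using (List; []; _∷_)
open import Data.List.Membership.Propositional using (_∈_)
open import Data.List.Relation.Unary.All as All using (All; []; _∷_)
open import Data.List.Relation.Unary.AllPairs using ([]; _∷_)
open import Data.List.Relation.Unary.Any using (here; there)
open import Data.List.Relation.Unary.Unique.Propositional using (Unique)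
import Data.Maybe as Maybe
open import Data.Nat as ℕ using (ℕ; zero; suc; NonZero)
open import Data.Nat.Coprimality as Coprime using (Coprime; coprime-divisor)
open import Data.Nat.Divisibility
open import Data.Nat.GCD using (gcd; gcd[m,n]∣m; gcd[m,n]∣n; gcd-greatest; gcd[m,n]≢0)
open import Data.Nat.Induction using (<-rec)
open import Data.Nat.ListAction using (product)
open import Data.Nat.Primality using (Prime; euclidsLemma; prime⇒irreducible; prime⇒nonZero; prime[2]; ¬prime[1])
open import Data.Nat.Primality.Factorisation using (PrimeFactorisation; factorise)
import Data.Nat.Properties as ℕ
import Data.Nat.Solver as ℕ
open import Data.List.Membership.DecPropositional ℕ._≟_ using (_∈?_)
open import Data.Product using (_×_; _,_; ∃-syntax; proj₁; proj₂)
import Data.Product.Properties as Product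
open import Data.Rational as ℚ using (ℚ; mkℚ; 0ℚ; 1ℚ)
import Data.Rational.Properties as ℚ
import Data.Rational.Solver as ℚ
open import Data.Rational.Unnormalised as ℚᵘ using (mkℚᵘ; *≡*)
import Data.Rational.Unnormalised.Properties as ℚᵘ
open import Data.Sum using (_⊎_; inj₁; inj₂)
open import Function using (_∘_)
open import Function.Bundles using (_⇔_; Equivalence)
open import Level using (0ℓ)
open import Relation.Binary.Consequences using (dec⇒weaklyDec)
open import Relation.Binary.Definitions using (WeaklyDecidable; tri<; tri≈; tri>)
open import Relation.Binary.PropositionalEquality
open import Relation.Nullary using (¬_; Dec; yes; no; contradiction)
open import Relation.Nullary.Decidable using (⌊_⌋)

-- A single εⱼ of norm -1 has a negative conjugate, so it is not a square in a real multiquadratic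
-- field: the factors cannot be treated one at a time. Over i the obstruction of each εⱼ is the
-- Gaussian integer c + di of norm mⱼ, and multiplying collects these into the one number U + Vi.
-- That ∏ mⱼ is a perfect square makes r rational, and only then are r + U and r - U rational
-- integers whose square roots can be studied prime by prime.
--
-- The number i is never adjoined: Q is carried as the pair of its coordinates E, F. The tower is
-- used as a commutative ring in which nonzero integers are invertible.
--
-- Unique factorisation in ℤ[i] is avoided as well. Coprimality is carried by explicit Bézout
-- identities, and the divisor w of prescribed norm comes from a descent. Since z and z̄ may share
-- the factor 1 + i, this works for odd norms only; hence the split by the parity of 2a and 2b, with
-- 2 = -i(1 + i)² accounting for the even case.

-- Ring structure of quadratic extensions and of the tower

module QuadraticExtension {A : Set} {_+_ _*_ : A → A → A} { -_ : A → A} {0# 1# : A}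
  (isCR : IsCommutativeRing _≡_ _+_ _*_ -_ 0# 1#) (δ : A) where

  add mul : A × A → A × A → A × A
  add (a , b) (c , d) = (a + c) , (b + d)
  mul (a , b) (c , d) = ((a * c) + (δ * (b * d))) , ((a * d) + (b * c))

  neg : A × A → A × A
  neg (a , b) = (- a) , (- b)

  private
    ring : CommutativeRing 0ℓ 0ℓ
    ring = record { isCommutativeRing = isCR }
    module R = CommutativeRing ring
    open SemiringSolver R.commutativeSemiring

    comm : ∀ x y → mul x y ≡ mul y x
    comm (a , a′) (b , b′) = cong₂ _,_
      (solve 5 (λ d a a′ b b′ → a :* b :+ d :* (a′ :* b′) := b :* a :+ d :* (b′ :* a′)) refl δ a a′ b b′)
      (solve 4 (λ a a′ b b′ → a :* b′ :+ a′ :* b := b :* a′ :+ b′ :* a) refl a a′ b b′)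

    identityʳ : ∀ x → mul x (1# , 0#) ≡ x
    identityʳ (a , a′) = cong₂ _,_
      (solve 3 (λ d a a′ → a :* con 1 :+ d :* (a′ :* con 0) := a) refl δ a a′)
      (solve 2 (λ a a′ → a :* con 0 :+ a′ :* con 1 := a′) refl a a′)

    distribˡ : ∀ x y z → mul x (add y z) ≡ add (mul x y) (mul x z)
    distribˡ (a , a′) (b , b′) (c , c′) = cong₂ _,_
      (solve 7 (λ d a a′ b b′ c c′ → a :* (b :+ c) :+ d :* (a′ :* (b′ :+ c′))
         := (a :* b :+ d :* (a′ :* b′)) :+ (a :* c :+ d :* (a′ :* c′))) refl δ a a′ b b′ c c′)
      (solve 6 (λ a a′ b b′ c c′ → a :* (b′ :+ c′) :+ a′ :* (b :+ c)
         := (a :* b′ :+ a′ :* b) :+ (a :* c′ :+ a′ :* c)) refl a a′ b b′ c c′)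

  -- These are the operations of A[X]/(X² - δ). They agree definitionally with one storey of `MQ`
  -- for δ = p, and give ℤ[i] for δ = -1.
  isCommutativeRing : IsCommutativeRing _≡_ add mul neg (0# , 0#) (1# , 0#)
  isCommutativeRing = record
    { isRing = record
      { +-isAbelianGroup = record
        { isGroup = record
          { isMonoid = record
            { isSemigroup = record
              { isMagma = record { isEquivalence = isEquivalence ; ∙-cong = cong₂ add }
              ; assoc = λ (a , a′) (b , b′) (c , c′) → cong₂ _,_ (R.+-assoc a b c) (R.+-assoc a′ b′ c′) }
            ; identity = (λ (a , a′) → cong₂ _,_ (R.+-identityˡ a) (R.+-identityˡ a′))
                       , (λ (a , a′) → cong₂ _,_ (R.+-identityʳ a) (R.+-identityʳ a′)) }
          ; inverse = (λ (a , a′) → cong₂ _,_ (R.-‿inverseˡ a) (R.-‿inverseˡ a′))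
                    , (λ (a , a′) → cong₂ _,_ (R.-‿inverseʳ a) (R.-‿inverseʳ a′))
          ; ⁻¹-cong = cong neg }
        ; comm = λ (a , a′) (b , b′) → cong₂ _,_ (R.+-comm a b) (R.+-comm a′ b′) }
      ; *-cong = cong₂ mul
      ; *-assoc = λ (a , a′) (b , b′) (c , c′) → cong₂ _,_
          (solve 7 (λ d a a′ b b′ c c′ →
              (a :* b :+ d :* (a′ :* b′)) :* c :+ d :* ((a :* b′ :+ a′ :* b) :* c′)
              := a :* (b :* c :+ d :* (b′ :* c′)) :+ d :* (a′ :* (b :* c′ :+ b′ :* c))) refl δ a a′ b b′ c c′)
          (solve 7 (λ d a a′ b b′ c c′ →
              (a :* b :+ d :* (a′ :* b′)) :* c′ :+ (a :* b′ :+ a′ :* b) :* c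
              := a :* (b :* c′ :+ b′ :* c) :+ a′ :* (b :* c :+ d :* (b′ :* c′))) refl δ a a′ b b′ c c′)
      ; *-identity = (λ x → trans (comm (1# , 0#) x) (identityʳ x)) , identityʳ
      ; distrib = distribˡ , λ x y z →
          trans (comm (add y z) x) (trans (distribˡ x y z) (cong₂ add (comm x y) (comm x z))) }
    ; *-comm = comm }

mneg : ∀ ps → MQ ps → MQ ps
mneg [] x = ℚ.- x
mneg (p ∷ ps) (a , b) = (mneg ps a , mneg ps b)

MQ-isCommutativeRing : ∀ ps → IsCommutativeRing _≡_ (madd ps) (mmul ps) (mneg ps) (mconst ps 0ℚ) (mconst ps 1ℚ)
MQ-isCommutativeRing [] = ℚ.+-*-isCommutativeRing
MQ-isCommutativeRing (p ∷ ps) =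
  QuadraticExtension.isCommutativeRing (MQ-isCommutativeRing ps) (mconst ps (ℕ→ℚ p))

MQ-commutativeRing : List ℕ → CommutativeRing 0ℓ 0ℓ
MQ-commutativeRing ps = record { isCommutativeRing = MQ-isCommutativeRing ps }

mconst-+ : ∀ ps x y → mconst ps (x ℚ.+ y) ≡ madd ps (mconst ps x) (mconst ps y)
mconst-+ [] x y = refl
mconst-+ (p ∷ ps) x y = cong₂ _,_ (mconst-+ ps x y) (mconst-+ ps 0ℚ 0ℚ)

mconst-neg : ∀ ps x → mconst ps (ℚ.- x) ≡ mneg ps (mconst ps x)
mconst-neg [] x = refl
mconst-neg (p ∷ ps) x = cong₂ _,_ (mconst-neg ps x) (mconst-neg ps 0ℚ)

mconst-* : ∀ ps x y → mconst ps (x ℚ.* y) ≡ mmul ps (mconst ps x) (mconst ps y)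
mconst-* [] x y = refl
mconst-* (p ∷ ps) x y = cong₂ _,_
  (trans (mconst-* ps x y) (solve 3 (λ a b d → a :* b := a :* b :+ d :* (con 0 :* con 0)) refl (mconst ps x) (mconst ps y) (mconst ps (ℕ→ℚ p))))
  (solve 2 (λ a b → con 0 := a :* con 0 :+ con 0 :* b) refl (mconst ps x) (mconst ps y))
  where
    open SemiringSolver (CommutativeRing.commutativeSemiring (MQ-commutativeRing ps))

-- For variable `ps` equality in `MQ ps` does not compute, so coefficients are taken in ℚ, where it
-- is decidable, and mapped in by `mconst`.
module MQ-Solver (ps : List ℕ) where
  private
    R : AlmostCommutativeRing 0ℓ 0ℓ
    R = fromCommutativeRing (MQ-commutativeRing ps)
    morphism : CommutativeRing.rawRing ℚ.+-*-commutativeRing -Raw-AlmostCommutative⟶ R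
    morphism = record
      { ⟦_⟧ = mconst ps
      ; +-homo = mconst-+ ps
      ; *-homo = mconst-* ps
      ; -‿homo = mconst-neg ps
      ; 0-homo = refl
      ; 1-homo = refl }
    dec : WeaklyDecidable (Induced-equivalence morphism)
    dec x y = Maybe.map (cong (mconst ps)) (dec⇒weaklyDec ℚ._≟_ x y)
  open RingSolver (CommutativeRing.rawRing ℚ.+-*-commutativeRing) R morphism dec public

-- Gaussian square roots over the tower

module _ (ps : List ℕ) where
  open CommutativeRing (MQ-commutativeRing ps) hiding (refl; sym; trans)
  open MQ-Solver ps

  -- q = e + f i satisfies q² = x (u + v i) and q q̄ = x ρ.
  record GaussianRoot (x ρ u v : MQ ps) : Set where
    constructor gaussianRoot
    field
      e f : MQ ps
      re : e * e - f * f ≡ x * u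
      im : e * f + e * f ≡ x * v
      norm : e * e + f * f ≡ x * ρ

  GaussianRoot-1 : GaussianRoot 1# 1# 1# 0#
  GaussianRoot-1 = gaussianRoot 1# 0#
    (solve 0 (con 1ℚ :* con 1ℚ :- con 0ℚ :* con 0ℚ := con 1ℚ :* con 1ℚ) refl)
    (solve 0 (con 1ℚ :* con 0ℚ :+ con 1ℚ :* con 0ℚ := con 1ℚ :* con 0ℚ) refl)
    (solve 0 (con 1ℚ :* con 1ℚ :+ con 0ℚ :* con 0ℚ := con 1ℚ :* con 1ℚ) refl)

  -- Both defining relations are multiplicative in q; the new coordinates are those of (e + fi)(e′ +
  -- f′i).
  GaussianRoot-* : ∀ {x ρ u v x′ ρ′ u′ v′} → GaussianRoot x ρ u v → GaussianRoot x′ ρ′ u′ v′ →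
                   GaussianRoot (x * x′) (ρ * ρ′) (u * u′ - v * v′) (u * v′ + v * u′)
  GaussianRoot-* {x} {ρ} {u} {v} {x′} {ρ′} {u′} {v′}
    (gaussianRoot e f re im norm) (gaussianRoot e′ f′ re′ im′ norm′) =
    gaussianRoot (e * e′ - f * f′) (e * f′ + f * e′)
      (begin
        (e * e′ - f * f′) * (e * e′ - f * f′) - (e * f′ + f * e′) * (e * f′ + f * e′)
          ≡⟨ solve 4 (λ e f e′ f′ →
               (e :* e′ :- f :* f′) :* (e :* e′ :- f :* f′) :- (e :* f′ :+ f :* e′) :* (e :* f′ :+ f :* e′)
               := (e :* e :- f :* f) :* (e′ :* e′ :- f′ :* f′) :- (e :* f :+ e :* f) :* (e′ :* f′ :+ e′ :* f′))
               refl e f e′ f′ ⟩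
        (e * e - f * f) * (e′ * e′ - f′ * f′) - (e * f + e * f) * (e′ * f′ + e′ * f′)
          ≡⟨ cong₂ _-_ (cong₂ _*_ re re′) (cong₂ _*_ im im′) ⟩
        (x * u) * (x′ * u′) - (x * v) * (x′ * v′)
          ≡⟨ solve 6 (λ x u v x′ u′ v′ → (x :* u) :* (x′ :* u′) :- (x :* v) :* (x′ :* v′)
               := x :* x′ :* (u :* u′ :- v :* v′)) refl x u v x′ u′ v′ ⟩
        x * x′ * (u * u′ - v * v′) ∎)
      (begin
        (e * e′ - f * f′) * (e * f′ + f * e′) + (e * e′ - f * f′) * (e * f′ + f * e′)
          ≡⟨ solve 4 (λ e f e′ f′ →
               (e :* e′ :- f :* f′) :* (e :* f′ :+ f :* e′) :+ (e :* e′ :- f :* f′) :* (e :* f′ :+ f :* e′)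
               := (e :* e :- f :* f) :* (e′ :* f′ :+ e′ :* f′) :+ (e :* f :+ e :* f) :* (e′ :* e′ :- f′ :* f′))
               refl e f e′ f′ ⟩
        (e * e - f * f) * (e′ * f′ + e′ * f′) + (e * f + e * f) * (e′ * e′ - f′ * f′)
          ≡⟨ cong₂ _+_ (cong₂ _*_ re im′) (cong₂ _*_ im re′) ⟩
        (x * u) * (x′ * v′) + (x * v) * (x′ * u′)
          ≡⟨ solve 6 (λ x u v x′ u′ v′ → (x :* u) :* (x′ :* v′) :+ (x :* v) :* (x′ :* u′)
               := x :* x′ :* (u :* v′ :+ v :* u′)) refl x u v x′ u′ v′ ⟩
        x * x′ * (u * v′ + v * u′) ∎)
      (begin
        (e * e′ - f * f′) * (e * e′ - f * f′) + (e * f′ + f * e′) * (e * f′ + f * e′)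
          ≡⟨ solve 4 (λ e f e′ f′ →
               (e :* e′ :- f :* f′) :* (e :* e′ :- f :* f′) :+ (e :* f′ :+ f :* e′) :* (e :* f′ :+ f :* e′)
               := (e :* e :+ f :* f) :* (e′ :* e′ :+ f′ :* f′))
               refl e f e′ f′ ⟩
        (e * e + f * f) * (e′ * e′ + f′ * f′)
          ≡⟨ cong₂ _*_ norm norm′ ⟩
        (x * ρ) * (x′ * ρ′)
          ≡⟨ solve 4 (λ x ρ x′ ρ′ → (x :* ρ) :* (x′ :* ρ′) := x :* x′ :* (ρ :* ρ′)) refl x ρ x′ ρ′ ⟩
        x * x′ * (ρ * ρ′) ∎)
    where open ≡-Reasoning

  -- With ε = a + b μ of norm -1, (ε + i)² = ε (2a + 2i); the root is (ε + i) / w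
  -- where 2a + 2i = (c + d i) w² and w = e + f i.
  GaussianRoot-unit : ∀ a b μ c d e f κ →
    a * a + 1# ≡ b * b * (μ * μ) →
    a + a ≡ c * (e * e - f * f) - d * (e * f + e * f) →
    1# + 1# ≡ c * (e * f + e * f) + d * (e * e - f * f) →
    b + b ≡ e * e + f * f →
    κ * (e * e + f * f) ≡ 1# →
    GaussianRoot (a + b * μ) μ c d
  GaussianRoot-unit a b μ c d e f κ unit re im w-norm κ-inv =
    -- As 1/w = κ w̄, these are the coordinates of κ (ε + i)(e - fi).
    gaussianRoot (κ * (ε * e + f)) (κ * (e - ε * f))
      (begin
        κ * (ε * e + f) * (κ * (ε * e + f)) - κ * (e - ε * f) * (κ * (e - ε * f))
          ≡⟨ solve 6 (λ a b μ e f κ → let ε = a :+ b :* μ in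
               κ :* (ε :* e :+ f) :* (κ :* (ε :* e :+ f)) :- κ :* (e :- ε :* f) :* (κ :* (e :- ε :* f))
               := κ :* κ :* ((b :* b :* (μ :* μ) :- (a :* a :+ con 1ℚ) :+ (a :+ a) :* ε) :* (e :* e :- f :* f)
                             :+ ε :* (e :* f :+ e :* f) :* (con 1ℚ :+ con 1ℚ))) refl a b μ e f κ ⟩
        Re (b * b * (μ * μ)) (a + a) (1# + 1#)
          ≡⟨ trans (cong (λ s → Re s (a + a) (1# + 1#)) (sym unit)) (cong₂ (Re (a * a + 1#)) re im) ⟩
        Re (a * a + 1#) (c * (e * e - f * f) - d * (e * f + e * f)) (c * (e * f + e * f) + d * (e * e - f * f))
          ≡⟨ solve 7 (λ a ε c d e f κ →
               κ :* κ :* ((a :* a :+ con 1ℚ :- (a :* a :+ con 1ℚ) :+ (c :* (e :* e :- f :* f) :- d :* (e :* f :+ e :* f)) :* ε) :* (e :* e :- f :* f)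
                          :+ ε :* (e :* f :+ e :* f) :* (c :* (e :* f :+ e :* f) :+ d :* (e :* e :- f :* f)))
               := ε :* c :* (κ :* (e :* e :+ f :* f) :* (κ :* (e :* e :+ f :* f)))) refl a ε c d e f κ ⟩
        ε * c * (κ * (e * e + f * f) * (κ * (e * e + f * f)))
          ≡⟨ cancel (ε * c) ⟩
        ε * c ∎)
      (begin
        κ * (ε * e + f) * (κ * (e - ε * f)) + κ * (ε * e + f) * (κ * (e - ε * f))
          ≡⟨ solve 6 (λ a b μ e f κ → let ε = a :+ b :* μ in
               κ :* (ε :* e :+ f) :* (κ :* (e :- ε :* f)) :+ κ :* (ε :* e :+ f) :* (κ :* (e :- ε :* f))
               := κ :* κ :* (ε :* (e :* e :- f :* f) :* (con 1ℚ :+ con 1ℚ)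
                  :- (b :* b :* (μ :* μ) :- (a :* a :+ con 1ℚ) :+ (a :+ a) :* ε) :* (e :* f :+ e :* f))) refl a b μ e f κ ⟩
        Im (b * b * (μ * μ)) (a + a) (1# + 1#)
          ≡⟨ trans (cong (λ s → Im s (a + a) (1# + 1#)) (sym unit)) (cong₂ (Im (a * a + 1#)) re im) ⟩
        Im (a * a + 1#) (c * (e * e - f * f) - d * (e * f + e * f)) (c * (e * f + e * f) + d * (e * e - f * f))
          ≡⟨ solve 7 (λ a ε c d e f κ →
               κ :* κ :* (ε :* (e :* e :- f :* f) :* (c :* (e :* f :+ e :* f) :+ d :* (e :* e :- f :* f))
                  :- (a :* a :+ con 1ℚ :- (a :* a :+ con 1ℚ) :+ (c :* (e :* e :- f :* f) :- d :* (e :* f :+ e :* f)) :* ε) :* (e :* f :+ e :* f))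
               := ε :* d :* (κ :* (e :* e :+ f :* f) :* (κ :* (e :* e :+ f :* f)))) refl a ε c d e f κ ⟩
        ε * d * (κ * (e * e + f * f) * (κ * (e * e + f * f)))
          ≡⟨ cancel (ε * d) ⟩
        ε * d ∎)
      (begin
        κ * (ε * e + f) * (κ * (ε * e + f)) + κ * (e - ε * f) * (κ * (e - ε * f))
          ≡⟨ solve 6 (λ a b μ e f κ → let ε = a :+ b :* μ in
               κ :* (ε :* e :+ f) :* (κ :* (ε :* e :+ f)) :+ κ :* (e :- ε :* f) :* (κ :* (e :- ε :* f))
               := κ :* κ :* (b :* b :* (μ :* μ) :+ (a :* a :+ con 1ℚ) :+ (a :+ a) :* (b :* μ)) :* (e :* e :+ f :* f)) refl a b μ e f κ ⟩
        Norm (a * a + 1#)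
          ≡⟨ cong Norm unit ⟩
        Norm (b * b * (μ * μ))
          ≡⟨ solve 6 (λ a b μ e f κ →
               κ :* κ :* (b :* b :* (μ :* μ) :+ b :* b :* (μ :* μ) :+ (a :+ a) :* (b :* μ)) :* (e :* e :+ f :* f)
               := (a :+ b :* μ) :* μ :* (κ :* (b :+ b) :* (κ :* (e :* e :+ f :* f)))) refl a b μ e f κ ⟩
        ε * μ * (κ * (b + b) * (κ * (e * e + f * f)))
          ≡⟨ cong (λ n → ε * μ * (κ * n * (κ * (e * e + f * f)))) w-norm ⟩
        ε * μ * (κ * (e * e + f * f) * (κ * (e * e + f * f)))
          ≡⟨ cancel (ε * μ) ⟩
        ε * μ ∎)
    where
      open ≡-Reasoning
      ε = a + b * μ
      -- The slots s, t, w hold b²μ², 2a and 2, where the hypotheses are to be rewritten. The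
      -- expression s - (a² + 1) + tε is ε² - 1, and its first difference vanishes because the norm
      -- is -1.
      Re Im : MQ ps → MQ ps → MQ ps → MQ ps
      Re s t w = κ * κ * ((s - (a * a + 1#) + t * ε) * (e * e - f * f) + ε * (e * f + e * f) * w)
      Im s t w = κ * κ * (ε * (e * e - f * f) * w - (s - (a * a + 1#) + t * ε) * (e * f + e * f))
      Norm : MQ ps → MQ ps
      Norm s = κ * κ * (b * b * (μ * μ) + s + (a + a) * (b * μ)) * (e * e + f * f)
      cancel : ∀ y → y * (κ * (e * e + f * f) * (κ * (e * e + f * f))) ≡ y
      cancel y = trans (cong (λ n → y * (n * n)) κ-inv) (solve 1 (λ y → y :* (con 1ℚ :* con 1ℚ) := y) refl y)

-- Gaussian integers

module _ where
  open import Data.Integer using (_+_; _*_; _-_; -_)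
  open ℤ.+-*-Solver

  ℤ[i] : Set
  ℤ[i] = ℤ × ℤ

  open QuadraticExtension ℤ.+-*-isCommutativeRing -1ℤ public
    renaming (mul to infixl 7 _·_; add to infixl 6 _⊕_; neg to ⊖_; isCommutativeRing to ℤ[i]-isCommutativeRing)

  ℤ[i]-commutativeRing : CommutativeRing 0ℓ 0ℓ
  ℤ[i]-commutativeRing = record { isCommutativeRing = ℤ[i]-isCommutativeRing }

  module ℤ[i]-Solver = SimpleSolver (fromCommutativeRing ℤ[i]-commutativeRing) (Product.≡-dec ℤ._≟_ ℤ._≟_)

  conj : ℤ[i] → ℤ[i]
  conj (a , b) = a , - b

  norm : ℤ[i] → ℤ
  norm (a , b) = a * a + b * b

  conj-· : ∀ z w → conj (z · w) ≡ conj z · conj w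
  conj-· (a , b) (c , d) = cong₂ _,_
    (solve 4 (λ a b c d → a :* c :+ con -1ℤ :* (b :* d) := a :* c :+ con -1ℤ :* (:- b :* :- d)) refl a b c d)
    (solve 4 (λ a b c d → :- (a :* d :+ b :* c) := a :* :- d :+ :- b :* c) refl a b c d)

  norm-· : ∀ z w → norm (z · w) ≡ norm z * norm w
  norm-· (a , b) (c , d) = solve 4 (λ a b c d →
    (a :* c :+ con -1ℤ :* (b :* d)) :* (a :* c :+ con -1ℤ :* (b :* d)) :+ (a :* d :+ b :* c) :* (a :* d :+ b :* c)
    := (a :* a :+ b :* b) :* (c :* c :+ d :* d)) refl a b c d

  ·-conj : ∀ z → z · conj z ≡ (norm z , 0ℤ)
  ·-conj (a , b) = cong₂ _,_
    (solve 2 (λ a b → a :* a :+ con -1ℤ :* (b :* :- b) := a :* a :+ b :* b) refl a b)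
    (solve 2 (λ a b → a :* :- b :+ b :* a := con 0ℤ) refl a b)

  ι-· : ∀ m n → (m , 0ℤ) · (n , 0ℤ) ≡ (m * n , 0ℤ)
  ι-· m n = cong₂ _,_ (solve 2 (λ m n → m :* n :+ con -1ℤ :* (con 0ℤ :* con 0ℤ) := m :* n) refl m n)
                      (solve 2 (λ m n → m :* con 0ℤ :+ con 0ℤ :* n := con 0ℤ) refl m n)

  -- Comparing norms in w′w = r + i gives w the norm n. Then w w̄ = n, so w also divides r + i + tn,
  -- with cofactor w′ + t w̄.
  cofactor-divides : ∀ n′ .{{_ : ℕ.NonZero n′}} r n t w′ w → norm w′ ≡ + n′ → w′ · w ≡ (r , 1ℤ) →
                     r * r + 1ℤ ≡ + n′ * n → ∃[ w₁ ] norm w ≡ n × w · w₁ ≡ (r + t * n , 1ℤ)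
  cofactor-divides n′@(suc _) r n t w′ w norm-w′ w′w eq = w′ ⊕ (t , 0ℤ) · conj w , norm-w , (begin
    w · (w′ ⊕ (t , 0ℤ) · conj w)
      ≡⟨ S.solve 4 (λ w w′ t w̄ → w S.:* (w′ S.:+ t S.:* w̄) S.:= w′ S.:* w S.:+ t S.:* (w S.:* w̄)) refl w w′ (t , 0ℤ) (conj w) ⟩
    w′ · w ⊕ (t , 0ℤ) · (w · conj w)
      ≡⟨ cong₂ (λ a b → a ⊕ (t , 0ℤ) · b) w′w (trans (·-conj w) (cong (_, 0ℤ) norm-w)) ⟩
    (r , 1ℤ) ⊕ (t , 0ℤ) · (n , 0ℤ)
      ≡⟨ cong ((r , 1ℤ) ⊕_) (ι-· t n) ⟩
    (r + t * n , 1ℤ) ∎)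
    where
    open ≡-Reasoning
    module S = ℤ[i]-Solver
    norm-w : norm w ≡ n
    norm-w = ℤ.*-cancelˡ-≡ (+ n′) (norm w) n (begin
      + n′ * norm w      ≡⟨ cong (_* norm w) (sym norm-w′) ⟩
      norm w′ * norm w   ≡⟨ sym (norm-· w′ w) ⟩
      norm (w′ · w)      ≡⟨ cong norm w′w ⟩
      r * r + 1ℤ         ≡⟨ eq ⟩
      + n′ * n           ∎)

  -- Descent: reducing h modulo n gives h² + 1 = n n′ with n′ < n, and a divisor of norm n′
  -- of h + i has a cofactor of norm n.
  divisor-of-norm : ∀ n → .{{ℕ.NonZero n}} → ∀ h n′ → h * h + 1ℤ ≡ + n * n′ →
                    ∃[ w ] ∃[ w′ ] norm w ≡ + n × w · w′ ≡ (h , 1ℤ)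
  divisor-of-norm = <-rec P step
    where
    P : ℕ → Set
    P n = .{{ℕ.NonZero n}} → ∀ h n′ → h * h + 1ℤ ≡ + n * n′ →
          ∃[ w ] ∃[ w′ ] norm w ≡ + n × w · w′ ≡ (h , 1ℤ)

    reduce : ∀ n .{{_ : ℕ.NonZero n}} h n′ → h * h + 1ℤ ≡ + n * n′ →
             ∃[ n″ ] (+ (h %ℕ n) * + (h %ℕ n) + 1ℤ ≡ + n * n″)
    reduce n h n′ eq = n′ - t * (h + h) + t * t * + n , (begin
      r * r + 1ℤ ≡⟨ solve 3 (λ r t n → r :* r :+ con 1ℤ :=
                      (r :+ t :* n) :* (r :+ t :* n) :+ con 1ℤ :- n :* (t :* ((r :+ t :* n) :+ (r :+ t :* n)) :- t :* t :* n)) refl r t (+ n) ⟩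
      (r + t * + n) * (r + t * + n) + 1ℤ - + n * (t * ((r + t * + n) + (r + t * + n)) - t * t * + n)
        ≡⟨ cong (λ h → h * h + 1ℤ - + n * (t * (h + h) - t * t * + n)) (sym (a≡a%ℕn+[a/ℕn]*n h n)) ⟩
      h * h + 1ℤ - + n * (t * (h + h) - t * t * + n)
        ≡⟨ cong (λ s → s - + n * (t * (h + h) - t * t * + n)) eq ⟩
      + n * n′ - + n * (t * (h + h) - t * t * + n)
        ≡⟨ solve 4 (λ n n′ h t → n :* n′ :- n :* (t :* (h :+ h) :- t :* t :* n)
             := n :* (n′ :- t :* (h :+ h) :+ t :* t :* n)) refl (+ n) n′ h t ⟩
      + n * (n′ - t * (h + h) + t * t * + n) ∎)
      where
      open ≡-Reasoning
      t = h /ℕ n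
      r = + (h %ℕ n)

    -- Since r² + 1 > 0 the cofactor cannot be negative, and the descent may run over ℕ.
    nonneg-factor : ∀ n .{{_ : ℕ.NonZero n}} r k → + r * + r + 1ℤ ≡ + n * k → ∃[ n″ ] suc (r ℕ.* r) ≡ n ℕ.* n″
    nonneg-factor n@(suc _) r (+ k) eq = k , ℤ.+-injective (begin
      1ℤ + + (r ℕ.* r) ≡⟨ ℤ.+-comm 1ℤ (+ (r ℕ.* r)) ⟩
      + (r ℕ.* r) + 1ℤ ≡⟨ cong (_+ 1ℤ) (ℤ.pos-* r r) ⟩
      + r * + r + 1ℤ   ≡⟨ eq ⟩
      + n * + k        ≡⟨ sym (ℤ.pos-* n k) ⟩
      + (n ℕ.* k)      ∎)
      where open ≡-Reasoning
    nonneg-factor n@(suc _) r -[1+ k ] eq with trans (cong (_+ 1ℤ) (ℤ.pos-* r r)) eq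
    ... | ()

    -- The bound is r² + 1 ≤ rn + 1 < rn + n ≤ n²; the strict step is where n = 1 must be excluded.
    cofactor-< : ∀ n r n″ → 1 ℕ.< n → r ℕ.< n → suc (r ℕ.* r) ≡ n ℕ.* n″ → n″ ℕ.< n
    cofactor-< n r n″ 1<n r<n eq = ℕ.*-cancelˡ-< n n″ n (begin-strict
      n ℕ.* n″            ≡⟨ sym eq ⟩
      suc (r ℕ.* r)       ≤⟨ ℕ.s≤s (ℕ.*-monoʳ-≤ r (ℕ.<⇒≤ r<n)) ⟩
      suc (r ℕ.* n)       <⟨ ℕ.+-monoˡ-< (r ℕ.* n) 1<n ⟩
      n ℕ.+ r ℕ.* n       ≤⟨ ℕ.*-monoˡ-≤ n r<n ⟩
      n ℕ.* n             ∎)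
      where open ℕ.≤-Reasoning

    step : ∀ n → (∀ {n₁} → n₁ ℕ.< n → P n₁) → P n
    step 1 rec h n′ eq = (1ℤ , 0ℤ) , (h , 1ℤ) , refl ,
      CommutativeRing.*-identityˡ ℤ[i]-commutativeRing (h , 1ℤ)
    step n@(suc (suc _)) rec h n′ eq =
      let k , r²+1≡nk = reduce n h n′ eq
          n″ , r²+1≡nn″ = nonneg-factor n (h %ℕ n) k r²+1≡nk
      in descend n″ r²+1≡nn″
      where
      r = h %ℕ n
      descend : ∀ n″ → suc (r ℕ.* r) ≡ n ℕ.* n″ → ∃[ w ] ∃[ w′ ] norm w ≡ + n × w · w′ ≡ (h , 1ℤ)
      descend zero eq″ = contradiction (trans eq″ (ℕ.*-zeroʳ n)) λ ()
      descend n″@(suc _) eq″ =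
        let w′ , w , norm-w′ , w′w = rec (cofactor-< n r n″ (ℕ.s≤s (ℕ.s≤s ℕ.z≤n)) (n%ℕd<d h n) eq″) (+ r) (+ n) swapped
            w₁ , norm-w , ww₁ = cofactor-divides n″ (+ r) (+ n) (h /ℕ n) w′ w norm-w′ w′w swapped
        in w , w₁ , norm-w , trans ww₁ (cong (_, 1ℤ) (sym (a≡a%ℕn+[a/ℕn]*n h n)))
        where
        open ≡-Reasoning
        swapped : + r * + r + 1ℤ ≡ + n″ * + n
        swapped = begin
          + r * + r + 1ℤ   ≡⟨ cong (_+ 1ℤ) (sym (ℤ.pos-* r r)) ⟩
          + (r ℕ.* r) + 1ℤ ≡⟨ ℤ.+-comm (+ (r ℕ.* r)) 1ℤ ⟩
          + suc (r ℕ.* r)  ≡⟨ cong +_ (trans eq″ (ℕ.*-comm n n″)) ⟩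
          + (n″ ℕ.* n)     ≡⟨ ℤ.pos-* n″ n ⟩
          + n″ * + n       ∎

  -- gcd(z, z̄) divides 2, so a divisor w of odd norm n of a primitive z is coprime to z̄;
  -- as w² divides z z̄ it then divides z.
  primitive-norm-square : ∀ x y α β m n k .{{_ : ℕ.NonZero n}} →
    α * x + β * y ≡ 1ℤ → x * x + y * y ≡ m * (+ n * + n) → + n ≡ k + k + 1ℤ →
    ∃[ c ] ∃[ w ] (x , y) ≡ c · (w · w) × norm c ≡ m × norm w ≡ + n
  primitive-norm-square x y α β m n k bezout norm-z odd = result (divisor-of-norm n h (m * + n * norm t) h²+1)
    where
    open ≡-Reasoning
    module S = ℤ[i]-Solver
    z = x , y
    -- The Bézout coefficients are ordered so that the imaginary part of z t is αx + βy = 1.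
    t = β , α
    h = β * x - α * y
    zt : z · t ≡ (h , 1ℤ)
    zt = cong₂ _,_ (solve 4 (λ x y α β → x :* β :+ con -1ℤ :* (y :* α) := β :* x :- α :* y) refl x y α β)
      (trans (solve 4 (λ x y α β → x :* α :+ y :* β := α :* x :+ β :* y) refl x y α β) bezout)
    h²+1 : h * h + 1ℤ ≡ + n * (m * + n * norm t)
    h²+1 = begin
      norm (h , 1ℤ)      ≡⟨ cong norm (sym zt) ⟩
      norm (z · t)       ≡⟨ norm-· z t ⟩
      norm z * norm t    ≡⟨ cong (_* norm t) norm-z ⟩
      m * (+ n * + n) * norm t ≡⟨ solve 3 (λ m n s → m :* (n :* n) :* s := n :* (m :* n :* s)) refl m (+ n) (norm t) ⟩
      + n * (m * + n * norm t) ∎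
    result : ∃[ w ] ∃[ w′ ] norm w ≡ + n × w · w′ ≡ (h , 1ℤ) →
             ∃[ c ] ∃[ w ] z ≡ c · (w · w) × norm c ≡ m × norm w ≡ + n
    result (w , w′ , norm-w , ww′) = c , w , z≡ , norm-c , norm-w
      where
      w̄ = conj w
      z̄ = conj z
      -- Here w w′ = h + i and z̄ t̄ = h - i differ by 2i, and multiplying by ki turns this into
      -- -2k. Adding w w̄ = n = 2k + 1 leaves 1, an explicit Bézout identity for w and z̄.
      κ = 0ℤ , k
      p = w̄ ⊕ κ · w′
      s = ⊖ (κ · conj t)
      ww̄ : w · w̄ ≡ (+ n , 0ℤ)
      ww̄ = trans (·-conj w) (cong (_, 0ℤ) norm-w)
      coprime : w · p ⊕ z̄ · s ≡ (1ℤ , 0ℤ)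
      coprime = begin
        w · p ⊕ z̄ · s
          ≡⟨ S.solve 6 (λ w w̄ w′ κ z̄ t̄ → w S.:* (w̄ S.:+ κ S.:* w′) S.:+ z̄ S.:* (S.:- (κ S.:* t̄))
               S.:= w S.:* w̄ S.:+ κ S.:* (w S.:* w′ S.:- z̄ S.:* t̄)) refl w w̄ w′ κ z̄ (conj t) ⟩
        w · w̄ ⊕ κ · (w · w′ ⊕ ⊖ (z̄ · conj t))
          ≡⟨ cong₂ (λ a b → a ⊕ κ · b) (trans ww̄ (cong (_, 0ℤ) odd))
               (cong₂ (λ a b → a ⊕ ⊖ b) ww′ (trans (sym (conj-· z t)) (cong conj zt))) ⟩
        (k + k + 1ℤ , 0ℤ) ⊕ κ · ((h , 1ℤ) ⊕ ⊖ (h , - 1ℤ))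
          ≡⟨ cong₂ _,_ (solve 2 (λ k h → k :+ k :+ con 1ℤ :+ (con 0ℤ :* (h :- h) :+ con -1ℤ :* (k :* con (+ 2))) := con 1ℤ) refl k h)
               (solve 2 (λ k h → con 0ℤ :+ (con 0ℤ :* con (+ 2) :+ k :* (h :- h)) := con 0ℤ) refl k h) ⟩
        (1ℤ , 0ℤ) ∎
      -- Read off from z = z (wp + z̄s)²: one term contains w², and the others contain z z̄ = m n² =
      -- w² w̄² m.
      c = p · p · z ⊕ (w · p · s ⊕ w · p · s ⊕ z̄ · s · s) · (w̄ · w̄ · (m , 0ℤ))
      ww̄² : (w · w) · (w̄ · w̄ · (m , 0ℤ)) ≡ z · z̄
      ww̄² = begin
        (w · w) · (w̄ · w̄ · (m , 0ℤ))
          ≡⟨ S.solve 3 (λ w w̄ m → (w S.:* w) S.:* (w̄ S.:* w̄ S.:* m) S.:= m S.:* ((w S.:* w̄) S.:* (w S.:* w̄))) refl w w̄ (m , 0ℤ) ⟩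
        (m , 0ℤ) · ((w · w̄) · (w · w̄))
          ≡⟨ cong (λ a → (m , 0ℤ) · (a · a)) ww̄ ⟩
        (m , 0ℤ) · ((+ n , 0ℤ) · (+ n , 0ℤ))
          ≡⟨ trans (cong ((m , 0ℤ) ·_) (ι-· (+ n) (+ n))) (ι-· m (+ n * + n)) ⟩
        (m * (+ n * + n) , 0ℤ)
          ≡⟨ cong (_, 0ℤ) (sym norm-z) ⟩
        (norm z , 0ℤ)
          ≡⟨ sym (·-conj z) ⟩
        z · z̄ ∎
      z≡ : z ≡ c · (w · w)
      z≡ = begin
        z ≡⟨ S.solve 1 (λ z → z S.:= z S.:* (S.con (1ℤ , 0ℤ) S.:* S.con (1ℤ , 0ℤ))) refl z ⟩
        z · ((1ℤ , 0ℤ) · (1ℤ , 0ℤ))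
          ≡⟨ cong (λ a → z · (a · a)) (sym coprime) ⟩
        z · ((w · p ⊕ z̄ · s) · (w · p ⊕ z̄ · s))
          ≡⟨ S.solve 5 (λ w p z z̄ s → z S.:* ((w S.:* p S.:+ z̄ S.:* s) S.:* (w S.:* p S.:+ z̄ S.:* s))
               S.:= p S.:* p S.:* z S.:* (w S.:* w) S.:+ (w S.:* p S.:* s S.:+ w S.:* p S.:* s S.:+ z̄ S.:* s S.:* s) S.:* (z S.:* z̄))
               refl w p z z̄ s ⟩
        p · p · z · (w · w) ⊕ (w · p · s ⊕ w · p · s ⊕ z̄ · s · s) · (z · z̄)
          ≡⟨ cong (λ a → p · p · z · (w · w) ⊕ (w · p · s ⊕ w · p · s ⊕ z̄ · s · s) · a) (sym ww̄²) ⟩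
        p · p · z · (w · w) ⊕ (w · p · s ⊕ w · p · s ⊕ z̄ · s · s) · ((w · w) · (w̄ · w̄ · (m , 0ℤ)))
          ≡⟨ S.solve 4 (λ A B C W → A S.:* W S.:+ B S.:* (W S.:* C) S.:= (A S.:+ B S.:* C) S.:* W) refl
               (p · p · z) (w · p · s ⊕ w · p · s ⊕ z̄ · s · s) (w̄ · w̄ · (m , 0ℤ)) (w · w) ⟩
        c · (w · w) ∎
      norm-c : norm c ≡ m
      norm-c = cancel n (begin
        norm c * (+ n * + n)      ≡⟨ cong (λ a → norm c * (a * a)) (sym norm-w) ⟩
        norm c * (norm w * norm w) ≡⟨ cong (norm c *_) (sym (norm-· w w)) ⟩
        norm c * norm (w · w)     ≡⟨ sym (norm-· c (w · w)) ⟩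
        norm (c · (w · w))        ≡⟨ cong norm (sym z≡) ⟩
        norm z                    ≡⟨ norm-z ⟩
        m * (+ n * + n)           ∎)
        where
        cancel : ∀ n .{{_ : ℕ.NonZero n}} → ∀ {a b} → a * (+ n * + n) ≡ b * (+ n * + n) → a ≡ b
        cancel n@(suc _) {a} {b} eq = ℤ.*-cancelʳ-≡ a b (+ n * + n) eq

-- Square roots of rational integers in ℚ(√p₁,…,√pₜ)

module _ where
  open import Data.Nat using (_*_)

  ℤ→ℚ-+ : ∀ x y → ℤ→ℚ (x ℤ.+ y) ≡ ℤ→ℚ x ℚ.+ ℤ→ℚ y
  ℤ→ℚ-+ x y = ℚ.toℚᵘ-injective (begin
    ℚ.toℚᵘ (ℤ→ℚ (x ℤ.+ y))                 ≈⟨ ℚ.toℚᵘ-fromℚᵘ (mkℚᵘ (x ℤ.+ y) 0) ⟩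
    mkℚᵘ (x ℤ.+ y) 0                       ≈⟨ *≡* (cong (ℤ._* + 1) (sym (cong₂ ℤ._+_ (ℤ.*-identityʳ x) (ℤ.*-identityʳ y)))) ⟩
    mkℚᵘ x 0 ℚᵘ.+ mkℚᵘ y 0                 ≈⟨ ℚᵘ.+-cong (ℚᵘ.≃-sym (ℚ.toℚᵘ-fromℚᵘ (mkℚᵘ x 0))) (ℚᵘ.≃-sym (ℚ.toℚᵘ-fromℚᵘ (mkℚᵘ y 0))) ⟩
    ℚ.toℚᵘ (ℤ→ℚ x) ℚᵘ.+ ℚ.toℚᵘ (ℤ→ℚ y)     ≈⟨ ℚᵘ.≃-sym (ℚ.toℚᵘ-homo-+ (ℤ→ℚ x) (ℤ→ℚ y)) ⟩
    ℚ.toℚᵘ (ℤ→ℚ x ℚ.+ ℤ→ℚ y)               ∎)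
    where open import Relation.Binary.Reasoning.Setoid ℚᵘ.≃-setoid

  ℤ→ℚ-* : ∀ x y → ℤ→ℚ (x ℤ.* y) ≡ ℤ→ℚ x ℚ.* ℤ→ℚ y
  ℤ→ℚ-* x y = ℚ.toℚᵘ-injective (begin
    ℚ.toℚᵘ (ℤ→ℚ (x ℤ.* y))                 ≈⟨ ℚ.toℚᵘ-fromℚᵘ (mkℚᵘ (x ℤ.* y) 0) ⟩
    mkℚᵘ x 0 ℚᵘ.* mkℚᵘ y 0                 ≈⟨ ℚᵘ.*-cong (ℚᵘ.≃-sym (ℚ.toℚᵘ-fromℚᵘ (mkℚᵘ x 0))) (ℚᵘ.≃-sym (ℚ.toℚᵘ-fromℚᵘ (mkℚᵘ y 0))) ⟩
    ℚ.toℚᵘ (ℤ→ℚ x) ℚᵘ.* ℚ.toℚᵘ (ℤ→ℚ y)     ≈⟨ ℚᵘ.≃-sym (ℚ.toℚᵘ-homo-* (ℤ→ℚ x) (ℤ→ℚ y)) ⟩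
    ℚ.toℚᵘ (ℤ→ℚ x ℚ.* ℤ→ℚ y)               ∎)
    where open import Relation.Binary.Reasoning.Setoid ℚᵘ.≃-setoid

  ℤ→ℚ-neg : ∀ x → ℤ→ℚ (ℤ.- x) ≡ ℚ.- ℤ→ℚ x
  ℤ→ℚ-neg x = ℚ.toℚᵘ-injective (begin
    ℚ.toℚᵘ (ℤ→ℚ (ℤ.- x))                   ≈⟨ ℚ.toℚᵘ-fromℚᵘ (mkℚᵘ (ℤ.- x) 0) ⟩
    ℚᵘ.- mkℚᵘ x 0                          ≈⟨ ℚᵘ.-‿cong (ℚᵘ.≃-sym (ℚ.toℚᵘ-fromℚᵘ (mkℚᵘ x 0))) ⟩
    ℚᵘ.- ℚ.toℚᵘ (ℤ→ℚ x)                    ≈⟨ ℚᵘ.≃-sym (ℚ.toℚᵘ-homo‿- (ℤ→ℚ x)) ⟩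
    ℚ.toℚᵘ (ℚ.- ℤ→ℚ x)                     ∎)
    where open import Relation.Binary.Reasoning.Setoid ℚᵘ.≃-setoid

  ℤ→ℚ-injective : ∀ {x y} → ℤ→ℚ x ≡ ℤ→ℚ y → x ≡ y
  ℤ→ℚ-injective {x} {y} eq with ℚ.fromℚᵘ-injective {mkℚᵘ x 0} {mkℚᵘ y 0} eq
  ... | *≡* x1≡y1 = ℤ.*-cancelʳ-≡ x y (+ 1) x1≡y1

  ℕ→ℚ-* : ∀ m n → ℕ→ℚ (m * n) ≡ ℕ→ℚ m ℚ.* ℕ→ℚ n
  ℕ→ℚ-* m n = trans (cong ℤ→ℚ (ℤ.pos-* m n)) (ℤ→ℚ-* (+ m) (+ n))

  -- Coprimality and squares in ℕ

  gcd-cofactors : ∀ x y .{{_ : NonZero x}} → ∃[ x′ ] ∃[ y′ ]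
    x ≡ x′ * gcd x y × y ≡ y′ * gcd x y × Coprime x′ y′ × NonZero (gcd x y)
  gcd-cofactors x y = quotient g∣x , quotient g∣y , _∣_.equality g∣x , _∣_.equality g∣y , coprime , g≢0
    where
    g = gcd x y
    g∣x = gcd[m,n]∣m x y
    g∣y = gcd[m,n]∣n x y
    g≢0 : NonZero g
    g≢0 = ℕ.≢-nonZero (gcd[m,n]≢0 x y (inj₁ (ℕ.≢-nonZero⁻¹ x)))
    coprime : Coprime (quotient g∣x) (quotient g∣y)
    coprime {d} (d∣x′ , d∣y′) = ∣1⇒≡1 (*-cancelʳ-∣ g {{g≢0}} (subst (d * g ∣_) (sym (ℕ.*-identityˡ g))
      (gcd-greatest (subst (d * g ∣_) (sym (_∣_.equality g∣x)) (*-monoˡ-∣ g d∣x′))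
                    (subst (d * g ∣_) (sym (_∣_.equality g∣y)) (*-monoˡ-∣ g d∣y′)))))

  -- Euclid's lemma is applied twice to get a ∣ c. After one a is cancelled, it is applied twice
  -- more to get a ∣ c/a.
  coprime-square-divisor : ∀ {a b c} → Coprime a b → a * a ∣ b * b * c → a * a ∣ c
  coprime-square-divisor {a} {b} {c} a⊥b a²∣b²c with coprime-divisor a⊥b (coprime-divisor a⊥b a∣bbc)
    where
    a∣bbc : a ∣ b * (b * c)
    a∣bbc = subst (a ∣_) (ℕ.*-assoc b b c) (m*n∣⇒m∣ a a a²∣b²c)
  ... | divides zero refl = (a * a) ∣0
  ... | divides q@(suc _) refl with a
  ...   | zero = subst (0 ∣_) (sym (ℕ.*-zeroʳ q)) ∣-refl
  ...   | a@(suc _) = *-monoˡ-∣ a (coprime-divisor a⊥b (coprime-divisor a⊥b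
            (*-cancelʳ-∣ a (subst (a * a ∣_) (solve 3 (λ b q a → b :* b :* (q :* a) := b :* (b :* q) :* a) refl b q a) a²∣b²c))))
    where open ℕ.+-*-Solver

  -- The root is g = gcd(x, v). Writing x = x′g and v = v′g gives x′y = v′²g. Then x′ ∣ g since x′
  -- is coprime to v′, and g ∣ x′ since g divides x and so is coprime to y.
  coprime-product-square : ∀ {x y v} .{{_ : NonZero x}} → Coprime x y → x * y ≡ v * v → ∃[ c ] x ≡ c * c
  coprime-product-square {x} {y} {v} x⊥y xy≡vv with gcd-cofactors x v
  ... | x′ , v′ , x≡ , v≡ , x′⊥v′ , g≢0 = g , trans x≡ (cong (_* g) (∣-antisym x′∣g g∣x′))
    where
    open ≡-Reasoning
    open ℕ.+-*-Solver
    g = gcd x v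
    x′y≡ : x′ * y ≡ v′ * (v′ * g)
    x′y≡ = ℕ.*-cancelʳ-≡ _ _ g {{g≢0}} (begin
      x′ * y * g           ≡⟨ solve 3 (λ a b c → a :* b :* c := a :* c :* b) refl x′ y g ⟩
      x′ * g * y           ≡⟨ cong (_* y) (sym x≡) ⟩
      x * y                ≡⟨ xy≡vv ⟩
      v * v                ≡⟨ cong₂ _*_ v≡ v≡ ⟩
      v′ * g * (v′ * g)    ≡⟨ solve 2 (λ a b → a :* b :* (a :* b) := a :* (a :* b) :* b) refl v′ g ⟩
      v′ * (v′ * g) * g    ∎)
    x′∣g : x′ ∣ g
    x′∣g = coprime-divisor x′⊥v′ (coprime-divisor x′⊥v′ (subst (x′ ∣_) x′y≡ (m∣m*n y)))
    g∣x′ : g ∣ x′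
    g∣x′ = coprime-divisor {n = y} (λ (d∣g , d∣y) → x⊥y (∣-trans d∣g (gcd[m,n]∣m x v) , d∣y))
      (subst (g ∣_) (trans (sym x′y≡) (ℕ.*-comm x′ y)) (∣n⇒∣m*n v′ (n∣m*n v′)))

  -- The irrationality argument: once r/s is in lowest terms, its denominator divides r′² while
  -- being coprime to r′, so it is 1.
  square-quotient : ∀ {t s r} .{{_ : NonZero s}} → t * (s * s) ≡ r * r → ∃[ c ] t ≡ c * c × c * s ≡ r
  square-quotient {t} {s} {r} eq =
    let s′ , r′ , s≡ , r≡ , s′⊥r′ , g≢0 = gcd-cofactors s r
        g = gcd s r
        eq′ : t * (s′ * s′) ≡ r′ * r′
        eq′ = ℕ.*-cancelʳ-≡ _ _ g {{g≢0}} (ℕ.*-cancelʳ-≡ _ _ g {{g≢0}} (begin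
          t * (s′ * s′) * g * g     ≡⟨ solve 3 (λ t s g → t :* (s :* s) :* g :* g := t :* (s :* g :* (s :* g))) refl t s′ g ⟩
          t * (s′ * g * (s′ * g))   ≡⟨ cong (λ a → t * (a * a)) (sym s≡) ⟩
          t * (s * s)               ≡⟨ eq ⟩
          r * r                     ≡⟨ cong₂ _*_ r≡ r≡ ⟩
          r′ * g * (r′ * g)         ≡⟨ solve 2 (λ r g → r :* g :* (r :* g) := r :* r :* g :* g) refl r′ g ⟩
          r′ * r′ * g * g           ∎))
        s′≡1 : s′ ≡ 1
        s′≡1 = s′⊥r′ (∣-refl , coprime-divisor s′⊥r′ (subst (s′ ∣_) eq′ (∣n⇒∣m*n t (m∣m*n s′))))
    in r′ ,
       trans (trans (sym (ℕ.*-identityʳ t)) (cong (λ a → t * (a * a)) (sym s′≡1))) eq′ ,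
       trans (cong (r′ *_) (trans s≡ (trans (cong (_* g) s′≡1) (ℕ.*-identityˡ g)))) (sym r≡)
    where
    open ≡-Reasoning
    open ℕ.+-*-Solver

  square-class-trivial : ∀ {t s r} .{{_ : NonZero s}} → SquareFree t → t * (s * s) ≡ r * r → t ≡ 1 × s ≡ r
  square-class-trivial {t} {s} {r} sf eq =
    let c , t≡c² , cs≡r = square-quotient {t} {s} {r} eq
        c≡1 = sf c (∣-reflexive (sym t≡c²))
    in trans t≡c² (cong₂ _*_ c≡1 c≡1) , trans (sym (trans (cong (_* s) c≡1) (ℕ.*-identityˡ s))) cs≡r

  -- Square classes as sets of primes

  primeProduct : List ℕ → (ℕ → Bool) → ℕ
  primeProduct [] χ = 1
  primeProduct (p ∷ ps) χ = if χ p then p * primeProduct ps χ else primeProduct ps χ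

  -- Extends `msqrt` from the primes dividing some m to an arbitrary set χ of primes, because
  -- products of roots lead to symmetric differences of such sets.
  mroot : ∀ ps → (ℕ → Bool) → MQ ps
  mroot [] χ = 1ℚ
  mroot (p ∷ ps) χ = if χ p then (mconst ps 0ℚ , mroot ps χ) else (mroot ps χ , mconst ps 0ℚ)

  dividing : ℕ → ℕ → Bool
  dividing m p = ⌊ p ∣? m ⌋

  msqrt≡mroot : ∀ ps m → msqrt ps m ≡ mroot ps (dividing m)
  msqrt≡mroot [] m = refl
  msqrt≡mroot (p ∷ ps) m with p ∣? m
  ... | yes _ = cong (mconst ps 0ℚ ,_) (msqrt≡mroot ps m)
  ... | no _ = cong (_, mconst ps 0ℚ) (msqrt≡mroot ps m)

  module _ (p : ℕ) (ps : List ℕ) where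
    open CommutativeRing (MQ-commutativeRing ps) using (0#) renaming (_*_ to _⊗_)
    open MQ-Solver ps

    private
      P : MQ ps
      P = mconst ps (ℕ→ℚ p)

    mmul-00 : ∀ x y → mmul (p ∷ ps) (x , 0#) (y , 0#) ≡ (x ⊗ y , 0#)
    mmul-00 x y = cong₂ _,_
      (solve 3 (λ P x y → x :* y :+ P :* (con 0ℚ :* con 0ℚ) := x :* y) refl P x y)
      (solve 2 (λ x y → x :* con 0ℚ :+ con 0ℚ :* y := con 0ℚ) refl x y)

    mmul-01 : ∀ x y → mmul (p ∷ ps) (x , 0#) (0# , y) ≡ (0# , x ⊗ y)
    mmul-01 x y = cong₂ _,_
      (solve 3 (λ P x y → x :* con 0ℚ :+ P :* (con 0ℚ :* y) := con 0ℚ) refl P x y)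
      (solve 2 (λ x y → x :* y :+ con 0ℚ :* con 0ℚ := x :* y) refl x y)

    mmul-10 : ∀ x y → mmul (p ∷ ps) (0# , x) (y , 0#) ≡ (0# , x ⊗ y)
    mmul-10 x y = cong₂ _,_
      (solve 3 (λ P x y → con 0ℚ :* y :+ P :* (x :* con 0ℚ) := con 0ℚ) refl P x y)
      (solve 2 (λ x y → con 0ℚ :* con 0ℚ :+ x :* y := x :* y) refl x y)

    mmul-11 : ∀ x y → mmul (p ∷ ps) (0# , x) (0# , y) ≡ (P ⊗ (x ⊗ y) , 0#)
    mmul-11 x y = cong₂ _,_
      (solve 3 (λ P x y → con 0ℚ :* con 0ℚ :+ P :* (x :* y) := P :* (x :* y)) refl P x y)
      (solve 2 (λ x y → con 0ℚ :* y :+ x :* con 0ℚ := con 0ℚ) refl x y)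

  -- A prime in both sets contributes √p √p = p to the rational factor; a prime in exactly one keeps
  -- its root.
  mroot-* : ∀ ps χ ψ → mmul ps (mroot ps χ) (mroot ps ψ) ≡
    mmul ps (mconst ps (ℕ→ℚ (primeProduct ps (λ p → χ p ∧ ψ p)))) (mroot ps (λ p → χ p xor ψ p))
  mroot-* [] χ ψ = refl
  mroot-* (p ∷ ps) χ ψ with χ p | ψ p | mroot-* ps χ ψ
  ... | false | false | ih = trans (mmul-00 p ps _ _) (trans (cong (_, mconst ps 0ℚ) ih) (sym (mmul-00 p ps _ _)))
  ... | false | true  | ih = trans (mmul-01 p ps _ _) (trans (cong (mconst ps 0ℚ ,_) ih) (sym (mmul-01 p ps _ _)))
  ... | true  | false | ih = trans (mmul-10 p ps _ _) (trans (cong (mconst ps 0ℚ ,_) ih) (sym (mmul-01 p ps _ _)))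
  ... | true  | true  | ih = trans (mmul-11 p ps _ _) (trans (cong (_, mconst ps 0ℚ) (begin
    P ⊗ (mroot ps χ ⊗ mroot ps ψ)     ≡⟨ cong (P ⊗_) ih ⟩
    P ⊗ (mconst ps (ℕ→ℚ v) ⊗ z)       ≡⟨ sym (CommutativeRing.*-assoc (MQ-commutativeRing ps) P _ z) ⟩
    (P ⊗ mconst ps (ℕ→ℚ v)) ⊗ z       ≡⟨ cong (_⊗ z) (sym (trans (cong (mconst ps) (ℕ→ℚ-* p v)) (mconst-* ps (ℕ→ℚ p) (ℕ→ℚ v)))) ⟩
    mconst ps (ℕ→ℚ (p * v)) ⊗ z       ∎)) (sym (mmul-00 p ps _ _)))
    where
    open ≡-Reasoning
    _⊗_ = mmul ps
    P = mconst ps (ℕ→ℚ p)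
    z = mroot ps (λ p → χ p xor ψ p)
    v = primeProduct ps (λ p → χ p ∧ ψ p)

  -- The square of the relation `mroot-*`, at the level of integers.
  primeProduct-* : ∀ ps χ ψ → primeProduct ps χ * primeProduct ps ψ ≡
    primeProduct ps (λ p → χ p xor ψ p) * (primeProduct ps (λ p → χ p ∧ ψ p) * primeProduct ps (λ p → χ p ∧ ψ p))
  primeProduct-* [] χ ψ = refl
  primeProduct-* (p ∷ ps) χ ψ with χ p | ψ p | primeProduct-* ps χ ψ
  ... | true | true | ih = begin
    (p * x) * (p * y)  ≡⟨ solve 3 (λ p x y → (p :* x) :* (p :* y) := p :* p :* (x :* y)) refl p x y ⟩
    p * p * (x * y)    ≡⟨ cong (p * p *_) ih ⟩
    p * p * (z * (v * v)) ≡⟨ solve 3 (λ p z v → p :* p :* (z :* (v :* v)) := z :* (p :* v :* (p :* v))) refl p z v ⟩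
    z * (p * v * (p * v)) ∎
    where
    open ≡-Reasoning
    open ℕ.+-*-Solver
    x = primeProduct ps χ
    y = primeProduct ps ψ
    z = primeProduct ps (λ p → χ p xor ψ p)
    v = primeProduct ps (λ p → χ p ∧ ψ p)
  ... | true | false | ih = trans (ℕ.*-assoc p (primeProduct ps χ) _)
    (trans (cong (p *_) ih) (sym (ℕ.*-assoc p (primeProduct ps (λ p → χ p xor ψ p)) _)))
  ... | false | true | ih = begin
    x * (p * y)  ≡⟨ solve 3 (λ p x y → x :* (p :* y) := p :* (x :* y)) refl p x y ⟩
    p * (x * y)    ≡⟨ cong (p *_) ih ⟩
    p * (z * (v * v)) ≡⟨ sym (ℕ.*-assoc p z (v * v)) ⟩
    p * z * (v * v) ∎
    where
    open ≡-Reasoning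
    open ℕ.+-*-Solver
    x = primeProduct ps χ
    y = primeProduct ps ψ
    z = primeProduct ps (λ p → χ p xor ψ p)
    v = primeProduct ps (λ p → χ p ∧ ψ p)
  ... | false | false | ih = ih

  prime∤primeProduct : ∀ {p} ps χ → Prime p → All Prime ps → All (p ≢_) ps → ¬ p ∣ primeProduct ps χ
  prime∤primeProduct [] χ p-prime [] [] p∣1 = ¬prime[1] (subst Prime (∣1⇒≡1 p∣1) p-prime)
  prime∤primeProduct {p} (q ∷ ps) χ p-prime (q-prime ∷ primes) (p≢q ∷ p∉ps) p∣ with χ q
  ... | false = prime∤primeProduct ps χ p-prime primes p∉ps p∣
  ... | true with euclidsLemma q _ p-prime p∣
  ...   | inj₂ p∣ps = prime∤primeProduct ps χ p-prime primes p∉ps p∣ps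
  ...   | inj₁ p∣q with prime⇒irreducible q-prime p∣q
  ...     | inj₁ p≡1 = ¬prime[1] (subst Prime p≡1 p-prime)
  ...     | inj₂ p≡q = p≢q p≡q

  -- If p ∣ d, then p² ∣ pv forces p ∣ v. Otherwise d² is coprime to p and already divides v.
  squareFree-prime-* : ∀ {p v} → Prime p → ¬ p ∣ v → SquareFree v → SquareFree (p * v)
  squareFree-prime-* {p} {v} p-prime p∤v sf d d²∣pv with p ∣? d
  ... | yes p∣d = contradiction (*-cancelˡ-∣ p {{prime⇒nonZero p-prime}} (∣-trans (*-pres-∣ p∣d p∣d) d²∣pv)) p∤v
  ... | no p∤d = sf d (coprime-divisor d²⊥p d²∣pv)
    where
    d²⊥p : Coprime (d * d) p
    d²⊥p {e} (e∣d² , e∣p) with prime⇒irreducible p-prime e∣p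
    ... | inj₁ e≡1 = e≡1
    ... | inj₂ refl with euclidsLemma d d p-prime e∣d²
    ...   | inj₁ p∣d = contradiction p∣d p∤d
    ...   | inj₂ p∣d = contradiction p∣d p∤d

  squareFree-1 : SquareFree 1
  squareFree-1 d d²∣1 = ℕ.m*n≡1⇒m≡1 d d (∣1⇒≡1 d²∣1)

  primeProduct-squareFree : ∀ ps χ → All Prime ps → Unique ps → SquareFree (primeProduct ps χ)
  primeProduct-squareFree [] χ [] [] = squareFree-1
  primeProduct-squareFree (p ∷ ps) χ (p-prime ∷ primes) (p∉ps ∷ unique) with χ p
  ... | false = primeProduct-squareFree ps χ primes unique
  ... | true = squareFree-prime-* p-prime (prime∤primeProduct ps χ p-prime primes p∉ps)
                 (primeProduct-squareFree ps χ primes unique)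

  primeProduct-nonZero : ∀ ps χ → All Prime ps → NonZero (primeProduct ps χ)
  primeProduct-nonZero [] χ [] = _
  primeProduct-nonZero (p ∷ ps) χ (p-prime ∷ primes) with χ p
  ... | false = primeProduct-nonZero ps χ primes
  ... | true = ℕ.m*n≢0 p _ {{prime⇒nonZero p-prime}} {{primeProduct-nonZero ps χ primes}}

  primeProduct≡1⇒mroot≡1 : ∀ ps χ → All Prime ps → primeProduct ps χ ≡ 1 → mroot ps χ ≡ mconst ps 1ℚ
  primeProduct≡1⇒mroot≡1 [] χ [] eq = refl
  primeProduct≡1⇒mroot≡1 (p ∷ ps) χ (p-prime ∷ primes) eq with χ p
  ... | false = cong (_, mconst ps 0ℚ) (primeProduct≡1⇒mroot≡1 ps χ primes eq)
  ... | true = contradiction (subst Prime (ℕ.m*n≡1⇒m≡1 p _ eq) p-prime) ¬prime[1]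

  primeProduct-cong : ∀ {ps χ ψ} → All (λ p → χ p ≡ ψ p) ps → primeProduct ps χ ≡ primeProduct ps ψ
  primeProduct-cong [] = refl
  primeProduct-cong {p ∷ ps} (eq ∷ eqs) = cong₂ (λ b v → if b then p * v else v) eq (primeProduct-cong eqs)

  dividing-cong : ∀ {m n p} → (p ∣ m → p ∣ n) → (p ∣ n → p ∣ m) → dividing m p ≡ dividing n p
  dividing-cong {m} {n} {p} to from with p ∣? m | p ∣? n
  ... | yes _ | yes _ = refl
  ... | no _ | no _ = refl
  ... | yes p∣m | no p∤n = contradiction (to p∣m) p∤n
  ... | no p∤m | yes p∣n = contradiction (from p∣n) p∤m

  SupportedOn : List ℕ → ℕ → Set
  SupportedOn ps n = ∀ q → Prime q → q ∣ n → q ∈ ps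

  -- Primes are stripped off along the list. Square-freeness ensures that p no longer divides m/p,
  -- so the rest is supported on the tail; over the empty list no prime divides m, so m = 1.
  squareFree≡primeProduct : ∀ ps m .{{_ : NonZero m}} → All Prime ps → Unique ps → SquareFree m → SupportedOn ps m →
                            m ≡ primeProduct ps (dividing m)
  squareFree≡primeProduct [] m primes unique sf supp
    with PrimeFactorisation.factors (factorise m)
    | PrimeFactorisation.isFactorisation (factorise m)
    | PrimeFactorisation.factorsPrime (factorise m)
  ... | [] | eq | _ = eq
  ... | q ∷ qs | eq | q-prime ∷ _ with supp q q-prime (subst (q ∣_) (sym eq) (m∣m*n (product qs)))
  ...   | ()
  squareFree≡primeProduct (p ∷ ps) m (p-prime ∷ primes) (p∉ps ∷ unique) sf supp with p ∣? m
  ... | no p∤m = squareFree≡primeProduct ps m primes unique sf supp′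
    where
    supp′ : SupportedOn ps m
    supp′ q q-prime q∣m with supp q q-prime q∣m
    ... | here refl = contradiction q∣m p∤m
    ... | there q∈ps = q∈ps
  ... | yes (divides n refl) = begin
    n * p                            ≡⟨ ℕ.*-comm n p ⟩
    p * n                            ≡⟨ cong (p *_) (squareFree≡primeProduct ps n {{n≢0}} primes unique sf′ supp′) ⟩
    p * primeProduct ps (dividing n) ≡⟨ cong (p *_) (primeProduct-cong (All.tabulate same)) ⟩
    p * primeProduct ps (dividing (n * p)) ∎
    where
    open ≡-Reasoning
    n≢0 : NonZero n
    n≢0 = ℕ.m*n≢0⇒m≢0 n
    sf′ : SquareFree n
    sf′ d d²∣n = sf d (∣m⇒∣m*n p d²∣n)
    p∤n : ¬ p ∣ n
    p∤n p∣n = ¬prime[1] (subst Prime (sf p (*-pres-∣ p∣n ∣-refl)) p-prime)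
    supp′ : SupportedOn ps n
    supp′ q q-prime q∣n with supp q q-prime (∣m⇒∣m*n p q∣n)
    ... | here refl = contradiction q∣n p∤n
    ... | there q∈ps = q∈ps
    same : ∀ {q} → q ∈ ps → dividing n q ≡ dividing (n * p) q
    same {q} q∈ps = dividing-cong (∣m⇒∣m*n p) from
      where
      from : q ∣ n * p → q ∣ n
      from q∣np with euclidsLemma n p (All.lookup primes q∈ps) q∣np
      ... | inj₁ q∣n = q∣n
      ... | inj₂ q∣p with prime⇒irreducible p-prime q∣p
      ...   | inj₁ q≡1 = contradiction (subst Prime q≡1 (All.lookup primes q∈ps)) ¬prime[1]
      ...   | inj₂ q≡p = contradiction (sym q≡p) (All.lookup p∉ps q∈ps)

  primeProduct-false : ∀ ps → primeProduct ps (λ _ → false) ≡ 1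
  primeProduct-false [] = refl
  primeProduct-false (p ∷ ps) = primeProduct-false ps

  module _ (ps : List ℕ) (primes : All Prime ps) (unique : Unique ps) where
    open CommutativeRing (MQ-commutativeRing ps) using () renaming (_*_ to _⊗_)
    open MQ-Solver ps
    open ≡-Reasoning

    private
      ⌜_⌝ : ℕ → MQ ps
      ⌜ n ⌝ = mconst ps (ℕ→ℚ n)

      ⌜⌝-* : ∀ m n → ⌜ m * n ⌝ ≡ ⌜ m ⌝ ⊗ ⌜ n ⌝
      ⌜⌝-* m n = trans (cong (mconst ps) (ℕ→ℚ-* m n)) (mconst-* ps (ℕ→ℚ m) (ℕ→ℚ n))

    -- The diagonal case of `mroot-*`: a set meets itself in itself, and its symmetric difference
    -- with itself is empty.
    msqrt² : ∀ m .{{_ : NonZero m}} → SquareFree m → SupportedOn ps m → msqrt ps m ⊗ msqrt ps m ≡ ⌜ m ⌝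
    msqrt² m sf supp = begin
      msqrt ps m ⊗ msqrt ps m
        ≡⟨ cong₂ _⊗_ (msqrt≡mroot ps m) (msqrt≡mroot ps m) ⟩
      mroot ps χ ⊗ mroot ps χ
        ≡⟨ mroot-* ps χ χ ⟩
      ⌜ primeProduct ps (λ p → χ p ∧ χ p) ⌝ ⊗ mroot ps (λ p → χ p xor χ p)
        ≡⟨ cong₂ (λ a b → ⌜ a ⌝ ⊗ b)
             (trans (primeProduct-cong (All.universal (λ p → ∧-idem (χ p)) ps)) (sym (squareFree≡primeProduct ps m primes unique sf supp)))
             (primeProduct≡1⇒mroot≡1 ps _ primes (trans (primeProduct-cong (All.universal (λ p → xor-same (χ p)) ps)) (primeProduct-false ps))) ⟩
      ⌜ m ⌝ ⊗ mconst ps 1ℚ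
        ≡⟨ solve 1 (λ a → a :* con 1ℚ := a) refl ⌜ m ⌝ ⟩
      ⌜ m ⌝ ∎
      where χ = dividing m

    -- The square class of ∏ mᵢ is recorded as the set χ of primes dividing it to an odd power.
    mprod-msqrt : ∀ k (m : Fin k → ℕ) → (∀ i → NonZero (m i)) → (∀ i → SquareFree (m i)) → (∀ i → SupportedOn ps (m i)) →
      ∃[ χ ] ∃[ s ] NonZero s × prodℕ k m ≡ primeProduct ps χ * (s * s) ×
        mprod ps k (λ i → msqrt ps (m i)) ≡ ⌜ s ⌝ ⊗ mroot ps χ
    mprod-msqrt zero m m≢0 sf supp = (λ _ → false) , 1 , _ ,
      sym (trans (ℕ.*-identityʳ _) (primeProduct-false ps)) ,
      sym (trans (cong (⌜ 1 ⌝ ⊗_) (primeProduct≡1⇒mroot≡1 ps _ primes (primeProduct-false ps)))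
                 (solve 0 (con 1ℚ :* con 1ℚ := con 1ℚ) refl))
    mprod-msqrt (suc k) m m≢0 sf supp with mprod-msqrt k (m ∘ suc) (m≢0 ∘ suc) (sf ∘ suc) (supp ∘ suc)
    ... | χ , s , s≢0 , ∏m≡ , ∏√m≡ = (λ p → χ₀ p xor χ p) , v * s ,
      ℕ.m*n≢0 v s {{primeProduct-nonZero ps _ primes}} {{s≢0}} ,
      (begin
        m zero * prodℕ k (m ∘ suc)
          ≡⟨ cong₂ _*_ (squareFree≡primeProduct ps (m zero) {{m≢0 zero}} primes unique (sf zero) (supp zero)) ∏m≡ ⟩
        primeProduct ps χ₀ * (primeProduct ps χ * (s * s))
          ≡⟨ sym (ℕ.*-assoc (primeProduct ps χ₀) _ _) ⟩
        primeProduct ps χ₀ * primeProduct ps χ * (s * s)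
          ≡⟨ cong (_* (s * s)) (primeProduct-* ps χ₀ χ) ⟩
        primeProduct ps (λ p → χ₀ p xor χ p) * (v * v) * (s * s)
          ≡⟨ N.solve 3 (λ a v s → a N.:* (v N.:* v) N.:* (s N.:* s) N.:= a N.:* (v N.:* s N.:* (v N.:* s)))
               refl (primeProduct ps (λ p → χ₀ p xor χ p)) v s ⟩
        primeProduct ps (λ p → χ₀ p xor χ p) * (v * s * (v * s)) ∎) ,
      (begin
        msqrt ps (m zero) ⊗ mprod ps k (λ i → msqrt ps (m (suc i)))
          ≡⟨ cong₂ _⊗_ (msqrt≡mroot ps (m zero)) ∏√m≡ ⟩
        mroot ps χ₀ ⊗ (⌜ s ⌝ ⊗ mroot ps χ)
          ≡⟨ solve 3 (λ a b c → a :* (b :* c) := b :* (a :* c)) refl (mroot ps χ₀) ⌜ s ⌝ (mroot ps χ) ⟩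
        ⌜ s ⌝ ⊗ (mroot ps χ₀ ⊗ mroot ps χ)
          ≡⟨ cong (⌜ s ⌝ ⊗_) (mroot-* ps χ₀ χ) ⟩
        ⌜ s ⌝ ⊗ (⌜ v ⌝ ⊗ mroot ps (λ p → χ₀ p xor χ p))
          ≡⟨ solve 3 (λ a b c → a :* (b :* c) := b :* a :* c) refl ⌜ s ⌝ ⌜ v ⌝ (mroot ps (λ p → χ₀ p xor χ p)) ⟩
        ⌜ v ⌝ ⊗ ⌜ s ⌝ ⊗ mroot ps (λ p → χ₀ p xor χ p)
          ≡⟨ cong (_⊗ mroot ps (λ p → χ₀ p xor χ p)) (sym (⌜⌝-* v s)) ⟩
        ⌜ v * s ⌝ ⊗ mroot ps (λ p → χ₀ p xor χ p) ∎)
      where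
      module N = ℕ.+-*-Solver
      χ₀ = dividing (m zero)
      v = primeProduct ps (λ p → χ₀ p ∧ χ p)

    -- A square has trivial square class, so no prime of `ps` remains in χ. This also fixes the
    -- sign: the product of the formal roots is r itself, not merely some root of r².
    mprod-msqrt-square : ∀ k (m : Fin k → ℕ) → (∀ i → NonZero (m i)) → (∀ i → SquareFree (m i)) → (∀ i → SupportedOn ps (m i)) →
      ∀ r → prodℕ k m ≡ r * r → mprod ps k (λ i → msqrt ps (m i)) ≡ ⌜ r ⌝
    mprod-msqrt-square k m m≢0 sf supp r ∏m≡r² =
      let χ , s , s≢0 , ∏m≡ , ∏√m≡ = mprod-msqrt k m m≢0 sf supp
          t≡1 , s≡r = square-class-trivial {primeProduct ps χ} {s} {r} {{s≢0}} (primeProduct-squareFree ps χ primes unique) (trans (sym ∏m≡) ∏m≡r²)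
      in begin
        mprod ps k (λ i → msqrt ps (m i)) ≡⟨ ∏√m≡ ⟩
        ⌜ s ⌝ ⊗ mroot ps χ                ≡⟨ cong₂ (λ a b → ⌜ a ⌝ ⊗ b) s≡r (primeProduct≡1⇒mroot≡1 ps χ primes t≡1) ⟩
        ⌜ r ⌝ ⊗ mconst ps 1ℚ              ≡⟨ solve 1 (λ a → a :* con 1ℚ := a) refl ⌜ r ⌝ ⟩
        ⌜ r ⌝                             ∎

  IsSquare : ∀ ps → MQ ps → Set
  IsSquare ps x = ∃[ y ] mmul ps y y ≡ x

  prime-square : ∀ {ps p} → p ∈ ps → IsSquare ps (mconst ps (ℕ→ℚ p))
  prime-square {p ∷ ps} (here refl) = (mconst ps 0ℚ , mconst ps 1ℚ) , cong₂ _,_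
    (solve 1 (λ P → con 0ℚ :* con 0ℚ :+ P :* (con 1ℚ :* con 1ℚ) := P) refl (mconst ps (ℕ→ℚ p)))
    (solve 0 (con 0ℚ :* con 1ℚ :+ con 1ℚ :* con 0ℚ := con 0ℚ) refl)
    where open MQ-Solver ps
  prime-square {q ∷ ps} {p} (there p∈ps) = let y , y²≡p = prime-square p∈ps in
    (y , mconst ps 0ℚ) , cong₂ _,_
    (trans (solve 2 (λ y Q → y :* y :+ Q :* (con 0ℚ :* con 0ℚ) := y :* y) refl y (mconst ps (ℕ→ℚ q))) y²≡p)
    (solve 1 (λ y → y :* con 0ℚ :+ con 0ℚ :* y := con 0ℚ) refl y)
    where open MQ-Solver ps

  IsSquare-* : ∀ ps {x y} → IsSquare ps x → IsSquare ps y → IsSquare ps (mmul ps x y)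
  IsSquare-* ps (a , refl) (b , refl) = mmul ps a b ,
    solve 2 (λ a b → (a :* b) :* (a :* b) := (a :* a) :* (b :* b)) refl a b
    where open MQ-Solver ps

  -- Every prime factor, counted with multiplicity, has its root in the tower.
  supported-square : ∀ ps n .{{_ : NonZero n}} → SupportedOn ps n → IsSquare ps (mconst ps (ℕ→ℚ n))
  supported-square ps n supp = subst (λ n → IsSquare ps (mconst ps (ℕ→ℚ n))) (sym n≡)
    (go _ (PrimeFactorisation.factorsPrime (factorise n)) (λ q q-prime q∣ → supp q q-prime (subst (q ∣_) (sym n≡) q∣)))
    where
    n≡ = PrimeFactorisation.isFactorisation (factorise n)
    go : ∀ qs → All Prime qs → SupportedOn ps (product qs) → IsSquare ps (mconst ps (ℕ→ℚ (product qs)))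
    go [] [] _ = mconst ps 1ℚ , solve 0 (con 1ℚ :* con 1ℚ := con 1ℚ) refl
      where open MQ-Solver ps
    go (q ∷ qs) (q-prime ∷ primes) supp = subst (IsSquare ps)
      (sym (trans (cong (mconst ps) (ℕ→ℚ-* q (product qs))) (mconst-* ps _ _)))
      (IsSquare-* ps (prime-square (supp q q-prime (m∣m*n (product qs))))
        (go qs primes (λ q′ q′-prime q′∣ → supp q′ q′-prime (∣n⇒∣m*n q q′∣))))

-- Units of norm -1

module _ where
  open import Data.Integer using (_+_; _*_; _-_; -_)
  open ℤ.+-*-Solver
  open ≡-Reasoning

  Even Odd : ℤ → Set
  Even z = ∃[ k ] z ≡ k + k
  Odd z = ∃[ k ] z ≡ k + k + 1ℤ

  even⊎odd : ∀ z → Even z ⊎ Odd z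
  even⊎odd z = go (z %ℕ 2) (n%ℕd<d z 2) (a≡a%ℕn+[a/ℕn]*n z 2)
    where
    q = z /ℕ 2
    go : ∀ r → r ℕ.< 2 → z ≡ + r + q * + 2 → Even z ⊎ Odd z
    go 0 _ eq = inj₁ (q , trans eq (solve 1 (λ q → con 0ℤ :+ q :* con (+ 2) := q :+ q) refl q))
    go 1 _ eq = inj₂ (q , trans eq (solve 1 (λ q → con 1ℤ :+ q :* con (+ 2) := q :+ q :+ con 1ℤ) refl q))
    go (suc (suc _)) (ℕ.s≤s (ℕ.s≤s ())) _

  ∣x+x∣ : ∀ x → ∣ x + x ∣ ≡ 2 ℕ.* ∣ x ∣
  ∣x+x∣ x = trans (cong ∣_∣ (solve 1 (λ x → x :+ x := con (+ 2) :* x) refl x)) (ℤ.abs-* (+ 2) x)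

  1-not-even : ∀ x → 1ℤ ≢ x + x
  1-not-even x eq with ∣1⇒≡1 (divides ∣ x ∣ (trans (trans (cong ∣_∣ eq) (∣x+x∣ x)) (ℕ.*-comm 2 ∣ x ∣)))
  ... | ()

  ¬even∧odd : ∀ {z} → Even z → Odd z → ∀ {A : Set} → A
  ¬even∧odd {z} (k , eq) (l , eq′) = contradiction
    (trans (solve 1 (λ l → con 1ℤ := l :+ l :+ con 1ℤ :- (l :+ l)) refl l)
     (trans (cong (_- (l + l)) (trans (sym eq′) eq)) (solve 2 (λ k l → k :+ k :- (l :+ l) := (k :- l) :+ (k :- l)) refl k l)))
    (1-not-even (k - l))

  even-+ : ∀ {x y} → Even x → Even y → Even (x + y)
  even-+ (k , refl) (l , refl) = k + l , solve 2 (λ k l → k :+ k :+ (l :+ l) := k :+ l :+ (k :+ l)) refl k l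

  even-*ˡ : ∀ {x} y → Even x → Even (x * y)
  even-*ˡ y (k , refl) = k * y , solve 2 (λ k y → (k :+ k) :* y := k :* y :+ k :* y) refl k y

  even-*ʳ : ∀ x {y} → Even y → Even (x * y)
  even-*ʳ x (k , refl) = x * k , solve 2 (λ x k → x :* (k :+ k) := x :* k :+ x :* k) refl x k

  odd-* : ∀ {x y} → Odd x → Odd y → Odd (x * y)
  odd-* (k , refl) (l , refl) = k * l + k * l + k + l ,
    solve 2 (λ k l → (k :+ k :+ con 1ℤ) :* (l :+ l :+ con 1ℤ)
      := (k :* l :+ k :* l :+ k :+ l) :+ (k :* l :+ k :* l :+ k :+ l) :+ con 1ℤ) refl k l

  odd+odd : ∀ {x y} → Odd x → Odd y → Even (x + y)
  odd+odd (k , refl) (l , refl) = k + l + 1ℤ ,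
    solve 2 (λ k l → (k :+ k :+ con 1ℤ) :+ (l :+ l :+ con 1ℤ) := (k :+ l :+ con 1ℤ) :+ (k :+ l :+ con 1ℤ)) refl k l

  even+odd : ∀ {x y} → Even x → Odd y → Odd (x + y)
  even+odd (k , refl) (l , refl) = k + l ,
    solve 2 (λ k l → (k :+ k) :+ (l :+ l :+ con 1ℤ) := (k :+ l) :+ (k :+ l) :+ con 1ℤ) refl k l

  even⇒2∣ : ∀ {n} → Even (+ n) → 2 ∣ n
  even⇒2∣ (k , eq) = divides ∣ k ∣ (trans (cong ∣_∣ eq) (trans (∣x+x∣ k) (ℕ.*-comm 2 ∣ k ∣)))

  -- 2a + 2i = (c + d i) (e + f i)² for a unit ε = a + b√m = (A + n√m)/2 of norm -1.
  record GaussianFactor (m : ℕ) (A : ℤ) (n : ℕ) : Set where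
    field
      c d e f : ℤ
      re : A ≡ c * (e * e - f * f) - d * (e * f + e * f)
      im : 1ℤ + 1ℤ ≡ c * (e * f + e * f) + d * (e * e - f * f)
      norm-w : + n ≡ e * e + f * f
      norm-c : c * c + d * d ≡ + m
      -- Selects the right associate of c + di when m is odd; this parity survives multiplication
      -- and becomes that of V.
      d-even : ¬ 2 ∣ m → Even d

  -- The sum and the difference of e² and f² differ by 2f².
  odd-difference : ∀ e f {n} → Odd n → e * e + f * f ≡ n → Odd (e * e - f * f)
  odd-difference e f {n} n-odd eq = subst Odd
    (solve 2 (λ e f → (:- (f :* f) :+ :- (f :* f)) :+ (e :* e :+ f :* f) := e :* e :- f :* f) refl e f)
    (even+odd (- (f * f) , refl) (subst Odd (sym eq) n-odd))

  -- For A = 2q + 1 the number A + 2i is already primitive, by A - 2q = 1. In 2 = 2cef + d(e² - f²)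
  -- the last bracket is odd, so d is even.
  oddTrace : ∀ {m A n} .{{_ : NonZero n}} → Odd A → Odd (+ n) → A * A + + 4 ≡ + m * (+ n * + n) → GaussianFactor m A n
  oddTrace {m} {A} {n} (q , refl) (k , n-odd) eq = build (primitive-norm-square A (+ 2) 1ℤ (- q) (+ m) n k
    (solve 1 (λ q → con 1ℤ :* (q :+ q :+ con 1ℤ) :+ :- q :* con (+ 2) := con 1ℤ) refl q) eq n-odd)
    where
    build : ∃[ c ] ∃[ w ] (A , + 2) ≡ c · (w · w) × norm c ≡ + m × norm w ≡ + n → GaussianFactor m A n
    build ((c , d) , (e , f) , z≡ , norm-c , norm-w) = record
      { c = c ; d = d ; e = e ; f = f
      ; re = trans (cong proj₁ z≡) (solve 4 (λ c d e f →
          c :* (e :* e :+ con -1ℤ :* (f :* f)) :+ con -1ℤ :* (d :* (e :* f :+ f :* e))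
          := c :* (e :* e :- f :* f) :- d :* (e :* f :+ e :* f)) refl c d e f)
      ; im = im
      ; norm-w = sym norm-w
      ; norm-c = norm-c
      ; d-even = λ _ → d-even (even⊎odd d) }
      where
      im : + 2 ≡ c * (e * f + e * f) + d * (e * e - f * f)
      im = trans (cong proj₂ z≡) (solve 4 (λ c d e f →
          c :* (e :* f :+ f :* e) :+ d :* (e :* e :+ con -1ℤ :* (f :* f))
          := c :* (e :* f :+ e :* f) :+ d :* (e :* e :- f :* f)) refl c d e f)
      d-even : Even d ⊎ Odd d → Even d
      d-even (inj₁ d-even) = d-even
      d-even (inj₂ d-odd) = ¬even∧odd (subst Even im (1ℤ , refl))
        (even+odd (even-*ʳ c (e * f , refl)) (odd-* d-odd (odd-difference e f (k , n-odd) norm-w)))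

  -- Halving leaves q + i, primitive because its imaginary part is 1, and of norm mk². Restoring the
  -- factor 2 replaces c + di by -i(c + di) = d - ci and w by (1 + i)w.
  evenTrace : ∀ {m q k} .{{_ : NonZero k}} → Odd (+ k) → q * q + 1ℤ ≡ + m * (+ k * + k) → GaussianFactor m (q + q) (k ℕ.+ k)
  evenTrace {m} {q} {k} (l , k-odd) eq = build (primitive-norm-square q 1ℤ 0ℤ 1ℤ (+ m) k l
    (solve 1 (λ q → con 0ℤ :* q :+ con 1ℤ := con 1ℤ) refl q) eq k-odd)
    where
    -- 2 = -i (1 + i)²
    build : ∃[ c ] ∃[ w ] (q , 1ℤ) ≡ c · (w · w) × norm c ≡ + m × norm w ≡ + k → GaussianFactor m (q + q) (k ℕ.+ k)
    build ((c , d) , (e , f) , z≡ , norm-c , norm-w) = record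
      { c = d ; d = - c ; e = e - f ; f = e + f
      ; re = trans (cong₂ _+_ re re) (solve 4 (λ c d e f →
          let e′ = e :- f ; f′ = e :+ f ; s = c :* (e :* e :- f :* f) :- d :* (e :* f :+ e :* f) in
          s :+ s := d :* (e′ :* e′ :- f′ :* f′) :- (:- c) :* (e′ :* f′ :+ e′ :* f′)) refl c d e f)
      ; im = trans (cong₂ _+_ im im) (solve 4 (λ c d e f →
          let e′ = e :- f ; f′ = e :+ f ; s = c :* (e :* f :+ e :* f) :+ d :* (e :* e :- f :* f) in
          s :+ s := d :* (e′ :* f′ :+ e′ :* f′) :+ (:- c) :* (e′ :* e′ :- f′ :* f′)) refl c d e f)
      ; norm-w = trans (ℤ.pos-+ k k) (trans (cong₂ _+_ (sym norm-w) (sym norm-w)) (solve 2 (λ e f →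
          (e :* e :+ f :* f) :+ (e :* e :+ f :* f) := (e :- f) :* (e :- f) :+ (e :+ f) :* (e :+ f)) refl e f))
      ; norm-c = trans (solve 2 (λ c d → d :* d :+ :- c :* :- c := c :* c :+ d :* d) refl c d) norm-c
      ; d-even = λ 2∤m → -c-even 2∤m (even⊎odd c) }
      where
      re : q ≡ c * (e * e - f * f) - d * (e * f + e * f)
      re = trans (cong proj₁ z≡) (solve 4 (λ c d e f →
          c :* (e :* e :+ con -1ℤ :* (f :* f)) :+ con -1ℤ :* (d :* (e :* f :+ f :* e))
          := c :* (e :* e :- f :* f) :- d :* (e :* f :+ e :* f)) refl c d e f)
      im : 1ℤ ≡ c * (e * f + e * f) + d * (e * e - f * f)
      im = trans (cong proj₂ z≡) (solve 4 (λ c d e f →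
          c :* (e :* f :+ f :* e) :+ d :* (e :* e :+ con -1ℤ :* (f :* f))
          := c :* (e :* f :+ e :* f) :+ d :* (e :* e :- f :* f)) refl c d e f)
      -- From 1 = 2cef + d(e² - f²). If c were odd too, m = c² + d² would be even; so for odd m the
      -- new imaginary part -c is even.
      d-odd : Even d ⊎ Odd d → Odd d
      d-odd (inj₂ d-odd) = d-odd
      d-odd (inj₁ d-even) = ¬even∧odd (subst Even (sym im)
        (even-+ (even-*ʳ c (e * f , refl)) (even-*ˡ _ d-even))) (0ℤ , refl)
      -c-even : ¬ 2 ∣ m → Even c ⊎ Odd c → Even (- c)
      -c-even 2∤m (inj₁ (h , refl)) = - h , ℤ.neg-distrib-+ h h
      -c-even 2∤m (inj₂ c-odd) = contradiction
        (even⇒2∣ (subst Even norm-c (odd+odd (odd-* c-odd c-odd) (odd-* (d-odd (even⊎odd d)) (d-odd (even⊎odd d)))))) 2∤m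

  4∣⇒¬squareFree : ∀ m x → SquareFree m → + m ≢ + 4 * x
  4∣⇒¬squareFree m x sf eq with sf 2 (divides ∣ x ∣ (trans (cong ∣_∣ eq) (trans (ℤ.abs-* (+ 4) x) (ℕ.*-comm 4 ∣ x ∣))))
  ... | ()

  even-half : ∀ n → Even (+ n) → ∃[ k ] n ≡ k ℕ.+ k
  even-half n (+ k , eq) = k , ℤ.+-injective (trans eq (sym (ℤ.pos-+ k k)))

  -- Parity of A² + 4 = mn² rules out A odd with n even, and A even with n odd would give 4 ∣ m. For
  -- A = 2q, n = 2k the equation becomes q² + 1 = mk², where k is odd because -1 is not a square
  -- modulo 4.
  gaussianFactor : ∀ {m A n} .{{_ : NonZero n}} → SquareFree m → A * A + + 4 ≡ + m * (+ n * + n) → GaussianFactor m A n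
  gaussianFactor {m} {A} {n} sf eq = go (even⊎odd A) (even⊎odd (+ n))
    where
    half-odd : ∀ q k → q * q + 1ℤ ≡ + m * (+ k * + k) → Even (+ k) ⊎ Odd (+ k) → Odd (+ k)
    half-odd q k eq′ (inj₂ k-odd) = k-odd
    half-odd q k eq′ (inj₁ (l , k≡)) = half (even⊎odd q)
      where
      eq″ : q * q + 1ℤ ≡ + 4 * (+ m * (l * l))
      eq″ = trans eq′ (trans (cong (λ k → + m * (k * k)) k≡)
        (solve 2 (λ m l → m :* ((l :+ l) :* (l :+ l)) := con (+ 4) :* (m :* (l :* l))) refl (+ m) l))
      half : Even q ⊎ Odd q → Odd (+ k)
      half (inj₁ q-even) = ¬even∧odd (subst Even (sym eq″) (even-*ˡ _ (+ 2 , refl))) (even+odd (even-*ˡ q q-even) (0ℤ , refl))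
      -- With q = 2s + 1, q² + 1 = 4(s² + s) + 2 is not divisible by 4.
      half (inj₂ (s , refl)) = contradiction (ℤ.*-cancelˡ-≡ (+ 2) _ _ (begin
        + 2 * 1ℤ
          ≡⟨ solve 1 (λ s → con (+ 2) := (s :+ s :+ con 1ℤ) :* (s :+ s :+ con 1ℤ) :+ con 1ℤ :- con (+ 4) :* (s :* s :+ s)) refl s ⟩
        q * q + 1ℤ - + 4 * (s * s + s)
          ≡⟨ cong (_- + 4 * (s * s + s)) eq″ ⟩
        + 4 * (+ m * (l * l)) - + 4 * (s * s + s)
          ≡⟨ solve 2 (λ X Y → con (+ 4) :* X :- con (+ 4) :* Y := con (+ 2) :* ((X :- Y) :+ (X :- Y))) refl (+ m * (l * l)) (s * s + s) ⟩
        + 2 * ((+ m * (l * l) - (s * s + s)) + (+ m * (l * l) - (s * s + s))) ∎)) (1-not-even (+ m * (l * l) - (s * s + s)))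
    go : Even A ⊎ Odd A → Even (+ n) ⊎ Odd (+ n) → GaussianFactor m A n
    go (inj₂ A-odd) (inj₂ n-odd) = oddTrace A-odd n-odd eq
    go (inj₂ A-odd) (inj₁ n-even) = ¬even∧odd (subst Even (sym eq) (even-*ʳ (+ m) (even-*ˡ (+ n) n-even)))
      (subst Odd (ℤ.+-comm (+ 4) (A * A)) (even+odd (+ 2 , refl) (odd-* A-odd A-odd)))
    go (inj₁ (q , refl)) (inj₂ (k , n≡)) = contradiction (begin
        + m
          ≡⟨ solve 2 (λ m k → m := m :* ((k :+ k :+ con 1ℤ) :* (k :+ k :+ con 1ℤ)) :- con (+ 4) :* (m :* (k :* k :+ k))) refl (+ m) k ⟩
        + m * ((k + k + 1ℤ) * (k + k + 1ℤ)) - + 4 * (+ m * (k * k + k))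
          ≡⟨ cong (λ n → + m * (n * n) - + 4 * (+ m * (k * k + k))) (sym n≡) ⟩
        + m * (+ n * + n) - + 4 * (+ m * (k * k + k))
          ≡⟨ cong (_- + 4 * (+ m * (k * k + k))) (sym eq) ⟩
        A * A + + 4 - + 4 * (+ m * (k * k + k))
          ≡⟨ solve 2 (λ q X → (q :+ q) :* (q :+ q) :+ con (+ 4) :- con (+ 4) :* X
               := con (+ 4) :* (q :* q :+ con 1ℤ :- X)) refl q (+ m * (k * k + k)) ⟩
        + 4 * (q * q + 1ℤ - + m * (k * k + k)) ∎)
      (4∣⇒¬squareFree m _ sf)
    go (inj₁ (q , refl)) (inj₁ n-even) with even-half n n-even
    ... | suc k₁ , refl = evenTrace {m} {q} {k} (half-odd q k eq′ (even⊎odd (+ k))) eq′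
      where
      k = suc k₁
      eq′ : q * q + 1ℤ ≡ + m * (+ k * + k)
      eq′ = ℤ.*-cancelˡ-≡ (+ 4) _ _ (begin
        + 4 * (q * q + 1ℤ)        ≡⟨ solve 1 (λ q → con (+ 4) :* (q :* q :+ con 1ℤ) := (q :+ q) :* (q :+ q) :+ con (+ 4)) refl q ⟩
        (q + q) * (q + q) + + 4   ≡⟨ eq ⟩
        + m * (+ (k ℕ.+ k) * + (k ℕ.+ k)) ≡⟨ cong (λ x → + m * (x * x)) (ℤ.pos-+ k k) ⟩
        + m * ((+ k + + k) * (+ k + + k)) ≡⟨ solve 2 (λ m k → m :* ((k :+ k) :* (k :+ k)) := con (+ 4) :* (m :* (k :* k))) refl (+ m) (+ k) ⟩
        + 4 * (+ m * (+ k * + k)) ∎)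

-- Integrality of the coordinates of a unit

norm-1⇒ : ∀ m a b → qnorm m (a , b) ≡ ℚ.- 1ℚ → a ℚ.* a ℚ.+ 1ℚ ≡ ℕ→ℚ m ℚ.* (b ℚ.* b)
norm-1⇒ m a b eq = begin
  a ℚ.* a ℚ.+ 1ℚ
    ≡⟨ solve 2 (λ a x → a :* a :+ con 1ℚ := (a :* a :- x) :+ con 1ℚ :+ x) refl a x ⟩
  (a ℚ.* a ℚ.- x) ℚ.+ 1ℚ ℚ.+ x
    ≡⟨ cong (λ y → y ℚ.+ 1ℚ ℚ.+ x) eq ⟩
  (ℚ.- 1ℚ) ℚ.+ 1ℚ ℚ.+ x
    ≡⟨ solve 1 (λ x → con (ℚ.- 1ℚ) :+ con 1ℚ :+ x := x) refl x ⟩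
  x ∎
  where
  open ≡-Reasoning
  open ℚ.+-*-Solver
  x = ℕ→ℚ m ℚ.* (b ℚ.* b)

-- With x = a - 1, the norm condition reads mb² = a² + 1 = x² + 2x + 2. For x > 0 this exceeds x²,
-- against the case b < 0 of `IsPos`; for x ≥ 0 it is positive, against b = 0.
norm-1∧>1⇒0<b : ∀ m a b → qnorm m (a , b) ≡ ℚ.- 1ℚ → IsGtOne m (a , b) → 0ℚ ℚ.< b
norm-1∧>1⇒0<b m a b eq (inj₂ (inj₂ (_ , 0<b , _))) = 0<b
norm-1∧>1⇒0<b m a b eq (inj₂ (inj₁ (0<x , b<0 , mb²<x²))) = contradiction mb²<x² (ℚ.<-asym x²<mb²)
  where
  open ℚ.+-*-Solver
  x = a ℚ.- 1ℚ
  x²<mb² : x ℚ.* x ℚ.< ℕ→ℚ m ℚ.* (b ℚ.* b)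
  x²<mb² = begin-strict
    x ℚ.* x                         ≡⟨ sym (ℚ.+-identityʳ _) ⟩
    x ℚ.* x ℚ.+ 0ℚ                  <⟨ ℚ.+-monoʳ-< (x ℚ.* x) (ℚ.+-mono-< (ℚ.+-mono-< 0<x 0<x) (ℚ.+-mono-< (ℚ.positive⁻¹ 1ℚ) (ℚ.positive⁻¹ 1ℚ))) ⟩
    x ℚ.* x ℚ.+ (x ℚ.+ x ℚ.+ (1ℚ ℚ.+ 1ℚ)) ≡⟨ solve 1 (λ a → let x = a :- con 1ℚ in
                                        x :* x :+ (x :+ x :+ (con 1ℚ :+ con 1ℚ)) := a :* a :+ con 1ℚ) refl a ⟩
    a ℚ.* a ℚ.+ 1ℚ                  ≡⟨ norm-1⇒ m a b eq ⟩
    ℕ→ℚ m ℚ.* (b ℚ.* b)             ∎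
    where open ℚ.≤-Reasoning
norm-1∧>1⇒0<b m a b eq (inj₁ (0≤x , 0≤b , _)) with ℚ.<-cmp 0ℚ b
... | tri< 0<b _ _ = 0<b
... | tri> _ _ b<0 = contradiction (ℚ.<-≤-trans b<0 0≤b) (ℚ.<-irrefl refl)
... | tri≈ _ refl _ = contradiction 0<0 (ℚ.<-irrefl refl)
  where
  open ℚ.≤-Reasoning
  open ℚ.+-*-Solver
  x = a ℚ.- 1ℚ
  0≤x² : 0ℚ ℚ.≤ x ℚ.* x
  0≤x² = ℚ.nonNegative⁻¹ (x ℚ.* x) {{ℚ.nonNeg*nonNeg⇒nonNeg x {{ℚ.nonNegative 0≤x}} x {{ℚ.nonNegative 0≤x}}}}
  0<0 : 0ℚ ℚ.< 0ℚ
  0<0 = begin-strict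
    0ℚ ℚ.+ 0ℚ                       <⟨ ℚ.+-mono-≤-< 0≤x² (ℚ.+-mono-≤-< (ℚ.+-mono-≤ 0≤x 0≤x) (ℚ.+-mono-< (ℚ.positive⁻¹ 1ℚ) (ℚ.positive⁻¹ 1ℚ))) ⟩
    x ℚ.* x ℚ.+ (x ℚ.+ x ℚ.+ (1ℚ ℚ.+ 1ℚ)) ≡⟨ solve 1 (λ a → let x = a :- con 1ℚ in
                                        x :* x :+ (x :+ x :+ (con 1ℚ :+ con 1ℚ)) := a :* a :+ con 1ℚ) refl a ⟩
    a ℚ.* a ℚ.+ 1ℚ                  ≡⟨ norm-1⇒ m a b eq ⟩
    ℕ→ℚ m ℚ.* (0ℚ ℚ.* 0ℚ)           ≡⟨ ℚ.*-zeroʳ (ℕ→ℚ m) ⟩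
    0ℚ                              ∎

ℚ-*-↧ : ∀ q → q ℚ.* ℤ→ℚ (ℚ.↧ q) ≡ ℤ→ℚ (ℚ.↥ q)
ℚ-*-↧ q@record{} = ℚ.toℚᵘ-injective (begin
  ℚ.toℚᵘ (q ℚ.* ℤ→ℚ (ℚ.↧ q))             ≈⟨ ℚ.toℚᵘ-homo-* q (ℤ→ℚ (ℚ.↧ q)) ⟩
  ℚ.toℚᵘ q ℚᵘ.* ℚ.toℚᵘ (ℤ→ℚ (ℚ.↧ q))     ≈⟨ ℚᵘ.*-cong (ℚᵘ.≃-refl {ℚ.toℚᵘ q}) (ℚ.toℚᵘ-fromℚᵘ (mkℚᵘ (ℚ.↧ q) 0)) ⟩
  ℚ.toℚᵘ q ℚᵘ.* mkℚᵘ (ℚ.↧ q) 0           ≈⟨ *≡* (trans (ℤ.*-identityʳ _) (cong (λ d → ℚ.↥ q ℤ.* + d) (sym (ℕ.*-identityʳ (ℚ.↧ₙ q))))) ⟩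
  mkℚᵘ (ℚ.↥ q) 0                         ≈⟨ ℚᵘ.≃-sym (ℚ.toℚᵘ-fromℚᵘ (mkℚᵘ (ℚ.↥ q) 0)) ⟩
  ℚ.toℚᵘ (ℤ→ℚ (ℚ.↥ q))                   ∎)
  where
  open import Relation.Binary.Reasoning.Setoid ℚᵘ.≃-setoid

-- For q = n/d in lowest terms, d² divides n²m, hence m, and square-freeness gives d = 1.
integral-root : ∀ m q .{{_ : ℚ.Positive q}} N → SquareFree m → ℕ→ℚ m ℚ.* (q ℚ.* q) ≡ ℤ→ℚ N →
                ∃[ n ] NonZero n × q ≡ ℕ→ℚ n
integral-root m q@(mkℚ +[1+ n ] d-1 coprime) N sf eq = suc n , _ , (begin
  q                                ≡⟨ sym (ℚ.*-identityʳ q) ⟩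
  q ℚ.* ℤ→ℚ (+ 1)                  ≡⟨ cong (λ d → q ℚ.* ℕ→ℚ d) (sym d≡1) ⟩
  q ℚ.* ℤ→ℚ (+ d)                  ≡⟨ ℚ-*-↧ q ⟩
  ℕ→ℚ (suc n)                      ∎)
  where
  open ≡-Reasoning
  open ℚ.+-*-Solver
  d = suc d-1
  D = ℤ→ℚ (+ d)
  mn²≡Nd² : + m ℤ.* (+ suc n ℤ.* + suc n) ≡ N ℤ.* (+ d ℤ.* + d)
  mn²≡Nd² = ℤ→ℚ-injective (begin
    ℤ→ℚ (+ m ℤ.* (+ suc n ℤ.* + suc n)) ≡⟨ trans (ℤ→ℚ-* (+ m) _) (cong (ℕ→ℚ m ℚ.*_) (ℤ→ℚ-* (+ suc n) (+ suc n))) ⟩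
    ℕ→ℚ m ℚ.* (ℕ→ℚ (suc n) ℚ.* ℕ→ℚ (suc n)) ≡⟨ cong (λ x → ℕ→ℚ m ℚ.* (x ℚ.* x)) (sym (ℚ-*-↧ q)) ⟩
    ℕ→ℚ m ℚ.* (q ℚ.* D ℚ.* (q ℚ.* D)) ≡⟨ solve 3 (λ m q D → m :* (q :* D :* (q :* D)) := m :* (q :* q) :* (D :* D)) refl (ℕ→ℚ m) q D ⟩
    ℕ→ℚ m ℚ.* (q ℚ.* q) ℚ.* (D ℚ.* D) ≡⟨ cong (ℚ._* (D ℚ.* D)) eq ⟩
    ℤ→ℚ N ℚ.* (D ℚ.* D) ≡⟨ sym (trans (ℤ→ℚ-* N _) (cong (ℤ→ℚ N ℚ.*_) (ℤ→ℚ-* (+ d) (+ d)))) ⟩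
    ℤ→ℚ (N ℤ.* (+ d ℤ.* + d)) ∎)
  d²∣n²m : d ℕ.* d ∣ suc n ℕ.* suc n ℕ.* m
  d²∣n²m = divides ∣ N ∣ (begin
    suc n ℕ.* suc n ℕ.* m  ≡⟨ ℕ.*-comm (suc n ℕ.* suc n) m ⟩
    m ℕ.* (suc n ℕ.* suc n)  ≡⟨ sym (ℤ.abs-* (+ m) (+ suc n ℤ.* + suc n)) ⟩
    ∣ + m ℤ.* (+ suc n ℤ.* + suc n) ∣ ≡⟨ cong ∣_∣ mn²≡Nd² ⟩
    ∣ N ℤ.* (+ d ℤ.* + d) ∣ ≡⟨ ℤ.abs-* N (+ d ℤ.* + d) ⟩
    ∣ N ∣ ℕ.* (d ℕ.* d) ∎)
  d≡1 : d ≡ 1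
  d≡1 = sf d (coprime-square-divisor (Coprime.sym (Coprime.recompute coprime)) d²∣n²m)

-- The trace gives 2a = A ∈ ℤ. That 2b is an integer follows from m(2b)² = A² + 4, and b > 0 makes
-- it a positive natural number, fit to be the norm of w.
unit-integral : ∀ m ε → SquareFree m → IsFundamentalUnit m ε → qnorm m ε ≡ ℚ.- 1ℚ → let a , b = ε in
  ∃[ A ] ∃[ n ] NonZero n × a ℚ.+ a ≡ ℤ→ℚ A × b ℚ.+ b ≡ ℕ→ℚ n × A ℤ.* A ℤ.+ + 4 ≡ + m ℤ.* (+ n ℤ.* + n)
unit-integral m (a , b) sf ((((A , 2a≡A) , _) , _) , ε>1 , _) norm =
  let n , n≢0 , 2b≡n = integral-root m (b ℚ.+ b) {{2b-pos}} (A ℤ.* A ℤ.+ + 4) sf m4b²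
  in A , n , n≢0 , 2a≡A , 2b≡n , ℤ→ℚ-injective (begin
    ℤ→ℚ (A ℤ.* A ℤ.+ + 4)                ≡⟨ sym m4b² ⟩
    ℕ→ℚ m ℚ.* ((b ℚ.+ b) ℚ.* (b ℚ.+ b))  ≡⟨ cong (λ x → ℕ→ℚ m ℚ.* (x ℚ.* x)) 2b≡n ⟩
    ℕ→ℚ m ℚ.* (ℕ→ℚ n ℚ.* ℕ→ℚ n)          ≡⟨ sym (trans (ℤ→ℚ-* (+ m) _) (cong (ℕ→ℚ m ℚ.*_) (ℤ→ℚ-* (+ n) (+ n)))) ⟩
    ℤ→ℚ (+ m ℤ.* (+ n ℤ.* + n))          ∎)
  where
  open ≡-Reasoning
  open ℚ.+-*-Solver
  0<b = norm-1∧>1⇒0<b m a b norm ε>1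
  2b-pos : ℚ.Positive (b ℚ.+ b)
  2b-pos = ℚ.pos+pos⇒pos b {{ℚ.positive 0<b}} b {{ℚ.positive 0<b}}
  m4b² : ℕ→ℚ m ℚ.* ((b ℚ.+ b) ℚ.* (b ℚ.+ b)) ≡ ℤ→ℚ (A ℤ.* A ℤ.+ + 4)
  m4b² = begin
    ℕ→ℚ m ℚ.* ((b ℚ.+ b) ℚ.* (b ℚ.+ b))
      ≡⟨ solve 2 (λ m b → m :* ((b :+ b) :* (b :+ b)) := con (ℤ→ℚ (+ 4)) :* (m :* (b :* b))) refl (ℕ→ℚ m) b ⟩
    ℤ→ℚ (+ 4) ℚ.* (ℕ→ℚ m ℚ.* (b ℚ.* b))
      ≡⟨ cong (ℤ→ℚ (+ 4) ℚ.*_) (sym (norm-1⇒ m a b norm)) ⟩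
    ℤ→ℚ (+ 4) ℚ.* (a ℚ.* a ℚ.+ 1ℚ)
      ≡⟨ solve 1 (λ a → con (ℤ→ℚ (+ 4)) :* (a :* a :+ con 1ℚ) := (a :+ a) :* (a :+ a) :+ con (ℤ→ℚ (+ 4))) refl a ⟩
    (a ℚ.+ a) ℚ.* (a ℚ.+ a) ℚ.+ ℤ→ℚ (+ 4)
      ≡⟨ cong (λ x → x ℚ.* x ℚ.+ ℤ→ℚ (+ 4)) 2a≡A ⟩
    ℤ→ℚ A ℚ.* ℤ→ℚ A ℚ.+ ℤ→ℚ (+ 4)
      ≡⟨ sym (trans (ℤ→ℚ-+ (A ℤ.* A) (+ 4)) (cong (ℚ._+ ℤ→ℚ (+ 4)) (ℤ→ℚ-* A A))) ⟩
    ℤ→ℚ (A ℤ.* A ℤ.+ + 4) ∎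

-- Products of units

factor∣prodℕ : ∀ k (m : Fin k → ℕ) i → m i ∣ prodℕ k m
factor∣prodℕ (suc k) m zero = m∣m*n _
factor∣prodℕ (suc k) m (suc i) = ∣n⇒∣m*n (m zero) (factor∣prodℕ k (m ∘ suc) i)

prodℕ-nonZero : ∀ k (m : Fin k → ℕ) → (∀ i → NonZero (m i)) → NonZero (prodℕ k m)
prodℕ-nonZero zero m m≢0 = _
prodℕ-nonZero (suc k) m m≢0 = ℕ.m*n≢0 (m zero) _ {{m≢0 zero}} {{prodℕ-nonZero k (m ∘ suc) (m≢0 ∘ suc)}}

module _ (ps : List ℕ) where
  open CommutativeRing (MQ-commutativeRing ps) using (_+_; _*_; _-_; -_; 0#; 1#)
  open MQ-Solver ps
  open ≡-Reasoning

  mℤ : ℤ → MQ ps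
  mℤ z = mconst ps (ℤ→ℚ z)

  mℤ-+ : ∀ x y → mℤ (x ℤ.+ y) ≡ mℤ x + mℤ y
  mℤ-+ x y = trans (cong (mconst ps) (ℤ→ℚ-+ x y)) (mconst-+ ps (ℤ→ℚ x) (ℤ→ℚ y))

  mℤ-* : ∀ x y → mℤ (x ℤ.* y) ≡ mℤ x * mℤ y
  mℤ-* x y = trans (cong (mconst ps) (ℤ→ℚ-* x y)) (mconst-* ps (ℤ→ℚ x) (ℤ→ℚ y))

  mℤ-- : ∀ x y → mℤ (x ℤ.- y) ≡ mℤ x - mℤ y
  mℤ-- x y = trans (mℤ-+ x (ℤ.- y)) (cong (_+_ (mℤ x))
    (trans (cong (mconst ps) (ℤ→ℚ-neg y)) (mconst-neg ps (ℤ→ℚ y))))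

  -- The source of every division carried out in `MQ ps`.
  mℤ-inverse : ∀ n .{{_ : NonZero n}} → ∃[ κ ] κ * mℤ (+ n) ≡ 1#
  mℤ-inverse n = mconst ps (ℚ.1/ (ℕ→ℚ n)) ,
    trans (sym (mconst-* ps (ℚ.1/ (ℕ→ℚ n)) (ℕ→ℚ n))) (cong (mconst ps) (ℚ.*-inverseˡ (ℕ→ℚ n)))
    where instance
    n≢0 : ℚ.NonZero (ℕ→ℚ n)
    n≢0 = ℚ.≢-nonZero (λ eq → ℕ.≢-nonZero⁻¹ n (ℤ.+-injective (ℤ→ℚ-injective {+ n} {+ 0} eq)))

  -- Carries the integer identity 2a + 2i = (c + di)w² into the tower: κ inverts w w̄ = n = 2b, and
  -- `msqrt²` turns m into μ².
  unit-root : ∀ m .{{_ : NonZero m}} ε → All Prime ps → Unique ps → SquareFree m → SupportedOn ps m →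
    IsFundamentalUnit m ε → qnorm m ε ≡ ℚ.- 1ℚ →
    ∃[ u ] ∃[ v ] GaussianRoot ps (embed ps m ε) (msqrt ps m) (mℤ u) (mℤ v) ×
      u ℤ.* u ℤ.+ v ℤ.* v ≡ + m × (¬ 2 ∣ m → Even v)
  unit-root m (a , b) primes unique sf supp fund norm =
    let A , n , n≢0 , 2a≡A , 2b≡n , A²+4≡ = unit-integral m (a , b) sf fund norm
    in build A n {{n≢0}} 2a≡A 2b≡n (gaussianFactor {m} {A} {n} {{n≢0}} sf A²+4≡)
    where
    build : ∀ A n .{{_ : NonZero n}} → a ℚ.+ a ≡ ℤ→ℚ A → b ℚ.+ b ≡ ℕ→ℚ n → GaussianFactor m A n →
      ∃[ u ] ∃[ v ] GaussianRoot ps (embed ps m (a , b)) (msqrt ps m) (mℤ u) (mℤ v) ×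
        u ℤ.* u ℤ.+ v ℤ.* v ≡ + m × (¬ 2 ∣ m → Even v)
    build A n 2a≡A 2b≡n record { c = c ; d = d ; e = e ; f = f ; re = re ; im = im
                               ; norm-w = norm-w ; norm-c = norm-c ; d-even = d-even } =
      let κ , κn≡1 = mℤ-inverse n
          n≡ = trans (cong mℤ norm-w) (trans (mℤ-+ (e ℤ.* e) (f ℤ.* f)) (cong₂ _+_ (mℤ-* e e) (mℤ-* f f)))
          2ef≡ = trans (mℤ-+ (e ℤ.* f) (e ℤ.* f)) (cong₂ _+_ (mℤ-* e f) (mℤ-* e f))
          e²-f²≡ = trans (mℤ-- (e ℤ.* e) (f ℤ.* f)) (cong₂ _-_ (mℤ-* e e) (mℤ-* f f))
      in c , d , GaussianRoot-unit ps (mconst ps a) (mconst ps b) (msqrt ps m) (mℤ c) (mℤ d) (mℤ e) (mℤ f) κ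
        (begin
          mconst ps a * mconst ps a + 1#
            ≡⟨ cong (_+ 1#) (sym (mconst-* ps a a)) ⟩
          mconst ps (a ℚ.* a) + 1#
            ≡⟨ sym (mconst-+ ps (a ℚ.* a) 1ℚ) ⟩
          mconst ps (a ℚ.* a ℚ.+ 1ℚ)
            ≡⟨ cong (mconst ps) (norm-1⇒ m a b norm) ⟩
          mconst ps (ℕ→ℚ m ℚ.* (b ℚ.* b))
            ≡⟨ trans (mconst-* ps _ _) (cong (mconst ps (ℕ→ℚ m) *_) (mconst-* ps b b)) ⟩
          mconst ps (ℕ→ℚ m) * (mconst ps b * mconst ps b)
            ≡⟨ cong (_* (mconst ps b * mconst ps b)) (sym (msqrt² ps primes unique m sf supp)) ⟩
          msqrt ps m * msqrt ps m * (mconst ps b * mconst ps b)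
            ≡⟨ solve 2 (λ x y → x :* y := y :* x) refl (msqrt ps m * msqrt ps m) (mconst ps b * mconst ps b) ⟩
          mconst ps b * mconst ps b * (msqrt ps m * msqrt ps m) ∎)
        (begin
          mconst ps a + mconst ps a ≡⟨ sym (mconst-+ ps a a) ⟩
          mconst ps (a ℚ.+ a)       ≡⟨ cong (mconst ps) 2a≡A ⟩
          mℤ A                      ≡⟨ cong mℤ re ⟩
          mℤ (c ℤ.* (e ℤ.* e ℤ.- f ℤ.* f) ℤ.- d ℤ.* (e ℤ.* f ℤ.+ e ℤ.* f))
            ≡⟨ mℤ-- (c ℤ.* (e ℤ.* e ℤ.- f ℤ.* f)) (d ℤ.* (e ℤ.* f ℤ.+ e ℤ.* f)) ⟩
          mℤ (c ℤ.* (e ℤ.* e ℤ.- f ℤ.* f)) - mℤ (d ℤ.* (e ℤ.* f ℤ.+ e ℤ.* f))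
            ≡⟨ cong₂ _-_ (trans (mℤ-* c (e ℤ.* e ℤ.- f ℤ.* f)) (cong (mℤ c *_) e²-f²≡)) (trans (mℤ-* d (e ℤ.* f ℤ.+ e ℤ.* f)) (cong (mℤ d *_) 2ef≡)) ⟩
          mℤ c * (mℤ e * mℤ e - mℤ f * mℤ f) - mℤ d * (mℤ e * mℤ f + mℤ e * mℤ f) ∎)
        (begin
          1# + 1#                   ≡⟨ sym (mconst-+ ps 1ℚ 1ℚ) ⟩
          mℤ (1ℤ ℤ.+ 1ℤ)            ≡⟨ cong mℤ im ⟩
          mℤ (c ℤ.* (e ℤ.* f ℤ.+ e ℤ.* f) ℤ.+ d ℤ.* (e ℤ.* e ℤ.- f ℤ.* f))
            ≡⟨ mℤ-+ (c ℤ.* (e ℤ.* f ℤ.+ e ℤ.* f)) (d ℤ.* (e ℤ.* e ℤ.- f ℤ.* f)) ⟩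
          mℤ (c ℤ.* (e ℤ.* f ℤ.+ e ℤ.* f)) + mℤ (d ℤ.* (e ℤ.* e ℤ.- f ℤ.* f))
            ≡⟨ cong₂ _+_ (trans (mℤ-* c (e ℤ.* f ℤ.+ e ℤ.* f)) (cong (mℤ c *_) 2ef≡)) (trans (mℤ-* d (e ℤ.* e ℤ.- f ℤ.* f)) (cong (mℤ d *_) e²-f²≡)) ⟩
          mℤ c * (mℤ e * mℤ f + mℤ e * mℤ f) + mℤ d * (mℤ e * mℤ e - mℤ f * mℤ f) ∎)
        (trans (sym (mconst-+ ps b b)) (trans (cong (mconst ps) 2b≡n) n≡))
        (trans (cong (κ *_) (sym n≡)) κn≡1)
      , norm-c , d-even

  -- All three invariants are multiplicative. For the parity, an odd product has odd factors, and
  -- uv′ + vu′ is even when v and v′ are.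
  product-root : ∀ k (m : Fin k → ℕ) (x : Fin k → MQ ps) →
    (∀ i → ∃[ u ] ∃[ v ] GaussianRoot ps (x i) (msqrt ps (m i)) (mℤ u) (mℤ v) ×
      u ℤ.* u ℤ.+ v ℤ.* v ≡ + m i × (¬ 2 ∣ m i → Even v)) →
    ∃[ u ] ∃[ v ] GaussianRoot ps (mprod ps k x) (mprod ps k (λ i → msqrt ps (m i))) (mℤ u) (mℤ v) ×
      u ℤ.* u ℤ.+ v ℤ.* v ≡ + prodℕ k m × (¬ 2 ∣ prodℕ k m → Even v)
  product-root zero m x roots = 1ℤ , 0ℤ , GaussianRoot-1 ps , refl , λ _ → 0ℤ , refl
  product-root (suc k) m x roots =
    let u , v , root , norm , v-even = roots zero
        u′ , v′ , root′ , norm′ , v′-even = product-root k (m ∘ suc) (x ∘ suc) (roots ∘ suc)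
    in u ℤ.* u′ ℤ.- v ℤ.* v′ , u ℤ.* v′ ℤ.+ v ℤ.* u′ ,
       subst₂ (GaussianRoot ps _ _)
         (sym (trans (mℤ-- (u ℤ.* u′) (v ℤ.* v′)) (cong₂ _-_ (mℤ-* u u′) (mℤ-* v v′))))
         (sym (trans (mℤ-+ (u ℤ.* v′) (v ℤ.* u′)) (cong₂ _+_ (mℤ-* u v′) (mℤ-* v u′))))
         (GaussianRoot-* ps root root′) ,
       (begin
         (u ℤ.* u′ ℤ.- v ℤ.* v′) ℤ.* (u ℤ.* u′ ℤ.- v ℤ.* v′) ℤ.+ (u ℤ.* v′ ℤ.+ v ℤ.* u′) ℤ.* (u ℤ.* v′ ℤ.+ v ℤ.* u′)
           ≡⟨ Z.solve 4 (λ u v u′ v′ →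
                (u Z.:* u′ Z.:- v Z.:* v′) Z.:* (u Z.:* u′ Z.:- v Z.:* v′) Z.:+ (u Z.:* v′ Z.:+ v Z.:* u′) Z.:* (u Z.:* v′ Z.:+ v Z.:* u′)
                Z.:= (u Z.:* u Z.:+ v Z.:* v) Z.:* (u′ Z.:* u′ Z.:+ v′ Z.:* v′)) refl u v u′ v′ ⟩
         (u ℤ.* u ℤ.+ v ℤ.* v) ℤ.* (u′ ℤ.* u′ ℤ.+ v′ ℤ.* v′)
           ≡⟨ cong₂ ℤ._*_ norm norm′ ⟩
         + m zero ℤ.* + prodℕ k (m ∘ suc)
           ≡⟨ sym (ℤ.pos-* (m zero) (prodℕ k (m ∘ suc))) ⟩
         + prodℕ (suc k) m ∎) ,
       λ 2∤∏ → even-+ (even-*ʳ u (v′-even (2∤∏ ∘ ∣n⇒∣m*n (m zero)))) (even-*ˡ u′ (v-even (2∤∏ ∘ ∣m⇒∣m*n _)))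
    where module Z = ℤ.+-*-Solver

  -- (r + u)(r - u) = v², so r + u = g c² where g = gcd (r + u) (r - u) divides 2r.
  hypotenuse-square : ∀ r u v .{{_ : NonZero r}} → SupportedOn ps r → u ℕ.* u ℕ.+ v ℕ.* v ≡ r ℕ.* r →
    (¬ 2 ∈ ps → 2 ∣ r ℕ.+ u) → IsSquare ps (mℤ (+ (2 ℕ.* (r ℕ.+ u))))
  hypotenuse-square r u v supp eq even =
    let x′ , y′ , x≡ , y≡ , x′⊥y′ , g≢0 = gcd-cofactors x y {{x≢0}}
        instance _ = g≢0
        -- Dividing xy = v² by g² leaves coprime factors whose product is again a square.
        v′ , x′y′≡v′² , _ = square-quotient {x′ ℕ.* y′} {g} {v} (begin
          x′ ℕ.* y′ ℕ.* (g ℕ.* g)    ≡⟨ N.solve 3 (λ a b g → a N.:* b N.:* (g N.:* g) N.:= a N.:* g N.:* (b N.:* g)) refl x′ y′ g ⟩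
          x′ ℕ.* g ℕ.* (y′ ℕ.* g)    ≡⟨ sym (cong₂ ℕ._*_ x≡ y≡) ⟩
          x ℕ.* y                    ≡⟨ xy≡v² ⟩
          v ℕ.* v                    ∎)
        c , x′≡c² = coprime-product-square {x′} {y′} {v′} {{ℕ.m*n≢0⇒m≢0 x′ {{subst NonZero x≡ x≢0}}}} x′⊥y′ x′y′≡v′²
    in conclude c (trans x≡ (cong (ℕ._* g) x′≡c²)) (2 ∈? ps)
    where
    module N = ℕ.+-*-Solver
    x = r ℕ.+ u
    -- Nothing is truncated, as u² ≤ r² gives u ≤ r. This factor may be 0 while x is positive, which
    -- is why x is the one to be analysed.
    y = r ℕ.∸ u
    g = gcd x y
    x≢0 : NonZero x
    x≢0 = ℕ.≢-nonZero (λ x≡0 → ℕ.≢-nonZero⁻¹ r (ℕ.m+n≡0⇒m≡0 r x≡0))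
    u≤r : u ℕ.≤ r
    u≤r = ℕ.≮⇒≥ (λ r<u → ℕ.<-irrefl refl (ℕ.<-≤-trans (ℕ.*-mono-< r<u r<u) (subst (u ℕ.* u ℕ.≤_) eq (ℕ.m≤m+n _ _))))
    y+u≡r : y ℕ.+ u ≡ r
    y+u≡r = ℕ.m∸n+n≡m u≤r
    xy≡v² : x ℕ.* y ≡ v ℕ.* v
    xy≡v² = ℕ.+-cancelˡ-≡ (u ℕ.* u) _ _ (begin
      u ℕ.* u ℕ.+ (r ℕ.+ u) ℕ.* y              ≡⟨ cong (λ r → u ℕ.* u ℕ.+ (r ℕ.+ u) ℕ.* y) (sym y+u≡r) ⟩
      u ℕ.* u ℕ.+ (y ℕ.+ u ℕ.+ u) ℕ.* y        ≡⟨ N.solve 2 (λ u y → u N.:* u N.:+ (y N.:+ u N.:+ u) N.:* y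
            N.:= (y N.:+ u) N.:* (y N.:+ u)) refl u y ⟩
      (y ℕ.+ u) ℕ.* (y ℕ.+ u)                  ≡⟨ cong₂ ℕ._*_ y+u≡r y+u≡r ⟩
      r ℕ.* r                                  ≡⟨ sym eq ⟩
      u ℕ.* u ℕ.+ v ℕ.* v                      ∎)
    x+y≡2r : x ℕ.+ y ≡ 2 ℕ.* r
    x+y≡2r = begin
      r ℕ.+ u ℕ.+ y   ≡⟨ N.solve 3 (λ r u y → r N.:+ u N.:+ y N.:= r N.:+ (y N.:+ u)) refl r u y ⟩
      r ℕ.+ (y ℕ.+ u) ≡⟨ cong (r ℕ.+_) y+u≡r ⟩
      r ℕ.+ r         ≡⟨ N.solve 1 (λ r → r N.:+ r N.:= N.con 2 N.:* r) refl r ⟩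
      2 ℕ.* r         ∎
    g∣2r : g ∣ 2 ℕ.* r
    g∣2r = subst (g ∣_) x+y≡2r (∣m∣n⇒∣m+n (gcd[m,n]∣m x y) (gcd[m,n]∣n x y))
    supported-multiple : ∀ n c .{{_ : NonZero n}} → SupportedOn ps n → n ℕ.* (c ℕ.* c) ≡ 2 ℕ.* x → IsSquare ps (mℤ (+ (2 ℕ.* x)))
    supported-multiple n c supp-n eq = subst (IsSquare ps ∘ mℤ) (trans (sym (ℤ.pos-* n (c ℕ.* c))) (cong +_ eq))
      (subst (IsSquare ps) (sym (mℤ-* (+ n) (+ (c ℕ.* c))))
        (IsSquare-* ps (supported-square ps n supp-n)
          (mℤ (+ c) , trans (sym (mℤ-* (+ c) (+ c))) (cong mℤ (sym (ℤ.pos-* c c))))))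
    conclude : ∀ c → x ≡ c ℕ.* c ℕ.* g → Dec (2 ∈ ps) → IsSquare ps (mℤ (+ (2 ℕ.* x)))
    -- 2x = (2g)c², and each prime dividing 2g divides 2r.
    conclude c x≡ (yes 2∈ps) = supported-multiple (2 ℕ.* g) c {{ℕ.m*n≢0 2 g {{_}} {{g≢0}}}} supp-2g
      (trans (N.solve 2 (λ c g → N.con 2 N.:* g N.:* (c N.:* c) N.:= N.con 2 N.:* (c N.:* c N.:* g)) refl c g) (cong (2 ℕ.*_) (sym x≡)))
      where
      g≢0 : NonZero g
      g≢0 = ℕ.m*n≢0⇒n≢0 (c ℕ.* c) {{subst NonZero x≡ x≢0}}
      2-or-r : ∀ q → Prime q → q ∣ 2 ℕ.* r → q ∈ ps
      2-or-r q q-prime q∣2r with euclidsLemma 2 r q-prime q∣2r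
      ... | inj₂ q∣r = supp q q-prime q∣r
      ... | inj₁ q∣2 with prime⇒irreducible prime[2] q∣2
      ...   | inj₁ q≡1 = contradiction (subst Prime q≡1 q-prime) ¬prime[1]
      ...   | inj₂ refl = 2∈ps
      supp-2g : SupportedOn ps (2 ℕ.* g)
      supp-2g q q-prime q∣2g with euclidsLemma 2 g q-prime q∣2g
      ... | inj₁ q∣2 = 2-or-r q q-prime (∣m⇒∣m*n r q∣2)
      ... | inj₂ q∣g = 2-or-r q q-prime (∣-trans q∣g g∣2r)
    -- Now 2 has no root at hand. But x and y = 2r - x are even, so g = 2h with h ∣ r, and 2x =
    -- h(2c)² absorbs both factors 2.
    conclude c x≡ (no 2∉ps) = supported-multiple h (2 ℕ.* c) {{h≢0}} (λ q q-prime q∣h → supp q q-prime (∣-trans q∣h h∣r)) (begin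
      h ℕ.* (2 ℕ.* c ℕ.* (2 ℕ.* c))   ≡⟨ N.solve 2 (λ c h → h N.:* (N.con 2 N.:* c N.:* (N.con 2 N.:* c))
            N.:= N.con 2 N.:* (c N.:* c N.:* (h N.:* N.con 2))) refl c h ⟩
      2 ℕ.* (c ℕ.* c ℕ.* (h ℕ.* 2))   ≡⟨ cong (λ g → 2 ℕ.* (c ℕ.* c ℕ.* g)) (sym g≡) ⟩
      2 ℕ.* (c ℕ.* c ℕ.* g)           ≡⟨ cong (2 ℕ.*_) (sym x≡) ⟩
      2 ℕ.* x                         ∎)
      where
      2∣x = even 2∉ps
      2∣g : 2 ∣ g
      2∣g = gcd-greatest 2∣x (∣m+n∣m⇒∣n (subst (2 ∣_) (sym x+y≡2r) (m∣m*n r)) 2∣x)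
      h = quotient 2∣g
      g≡ = _∣_.equality 2∣g
      h≢0 : NonZero h
      h≢0 = ℕ.m*n≢0⇒m≢0 h {{subst NonZero g≡ (ℕ.m*n≢0⇒n≢0 (c ℕ.* c) {{subst NonZero x≡ x≢0}})}}
      h∣r : h ∣ r
      h∣r = *-cancelˡ-∣ 2 (subst (_∣ 2 ℕ.* r) (trans g≡ (ℕ.*-comm h 2)) g∣2r)

  -- The root is y/s, with 1/s written as s/n so that only an integer is inverted.
  square-cancel : ∀ {x y} n .{{_ : NonZero n}} → y * y ≡ x * mℤ (+ n) → IsSquare ps (mℤ (+ n)) → IsSquare ps x
  square-cancel {x} {y} n y²≡ (s , s²≡) = let κ , κn≡1 = mℤ-inverse n in y * s * κ , (begin
    y * s * κ * (y * s * κ)             ≡⟨ solve 3 (λ y s κ → y :* s :* κ :* (y :* s :* κ) := (y :* y) :* (s :* s) :* (κ :* κ)) refl y s κ ⟩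
    (y * y) * (s * s) * (κ * κ)         ≡⟨ cong₂ (λ a b → a * b * (κ * κ)) y²≡ s²≡ ⟩
    x * mℤ (+ n) * mℤ (+ n) * (κ * κ)   ≡⟨ solve 3 (λ x n κ → x :* n :* n :* (κ :* κ) := x :* ((κ :* n) :* (κ :* n))) refl x (mℤ (+ n)) κ ⟩
    x * ((κ * mℤ (+ n)) * (κ * mℤ (+ n))) ≡⟨ cong (λ a → x * (a * a)) κn≡1 ⟩
    x * (1# * 1#)                       ≡⟨ solve 1 (λ x → x :* (con 1ℚ :* con 1ℚ) := x) refl x ⟩
    x                                   ∎)

  -- 4e² = 2x(r + u) and 4f² = 2x(r - u); use the one whose right-hand factor is r + |u|.
  root⇒square : ∀ {x} r u v .{{_ : NonZero r}} → SupportedOn ps r → GaussianRoot ps x (mℤ (+ r)) (mℤ u) (mℤ v) →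
    u ℤ.* u ℤ.+ v ℤ.* v ≡ + (r ℕ.* r) → (¬ 2 ∈ ps → Even v) → (¬ 2 ∈ ps → ¬ 2 ∣ r) → IsSquare ps x
  root⇒square {x} r u v supp (gaussianRoot e f re im norm) u²+v²≡r² v-even r-odd =
    pick (ℤ.+∣i∣≡i⊎+∣i∣≡-i u)
    where
    n = 2 ℕ.* (r ℕ.+ ∣ u ∣)
    instance
      n≢0 : NonZero n
      n≢0 = ℕ.m*n≢0 2 (r ℕ.+ ∣ u ∣) {{_}} {{ℕ.≢-nonZero (λ eq → ℕ.≢-nonZero⁻¹ r (ℕ.m+n≡0⇒m≡0 r eq))}}
    abs-square : ∀ z → + (∣ z ∣ ℕ.* ∣ z ∣) ≡ z ℤ.* z
    abs-square (+ z) = ℤ.pos-* z z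
    abs-square -[1+ z ] = refl
    mn≡ : mℤ (+ n) ≡ mℤ (+ 2) * (mℤ (+ r) + mℤ (+ ∣ u ∣))
    mn≡ = trans (cong mℤ (trans (ℤ.pos-* 2 (r ℕ.+ ∣ u ∣)) (cong (+ 2 ℤ.*_) (ℤ.pos-+ r ∣ u ∣))))
            (trans (mℤ-* (+ 2) (+ r ℤ.+ + ∣ u ∣)) (cong (mℤ (+ 2) *_) (mℤ-+ (+ r) (+ ∣ u ∣))))
    abs-even : + ∣ u ∣ ≡ u ⊎ + ∣ u ∣ ≡ ℤ.- u → Even (+ ∣ u ∣) → Even u
    abs-even (inj₁ eq) ev = subst Even eq ev
    abs-even (inj₂ eq) (h , ev) = ℤ.- h , trans (sym (ℤ.neg-involutive u)) (trans (cong ℤ.-_ (trans (sym eq) ev)) (ℤ.neg-distrib-+ h h))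
    -- Here r is odd and v even, so u² = r² - v² is odd and r + ∣u∣ is a sum of two odd numbers.
    2∣r+∣u∣ : ¬ 2 ∈ ps → 2 ∣ r ℕ.+ ∣ u ∣
    2∣r+∣u∣ 2∉ps = even⇒2∣ (subst Even (sym (ℤ.pos-+ r ∣ u ∣)) (odd+odd r-odd′ (u-odd (even⊎odd (+ ∣ u ∣)))))
      where
      to-odd : Even (+ r) ⊎ Odd (+ r) → Odd (+ r)
      to-odd (inj₁ r-even) = contradiction (even⇒2∣ r-even) (r-odd 2∉ps)
      to-odd (inj₂ r-odd) = r-odd
      r-odd′ = to-odd (even⊎odd (+ r))
      u-odd : Even (+ ∣ u ∣) ⊎ Odd (+ ∣ u ∣) → Odd (+ ∣ u ∣)
      u-odd (inj₂ u-odd) = u-odd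
      u-odd (inj₁ ev) = ¬even∧odd
        (even-+ (even-*ˡ u (abs-even (ℤ.+∣i∣≡i⊎+∣i∣≡-i u) ev)) (even-*ˡ v (v-even 2∉ps)))
        (subst Odd (trans (sym (ℤ.pos-* r r)) (sym u²+v²≡r²)) (odd-* r-odd′ r-odd′))
    n-square : IsSquare ps (mℤ (+ n))
    n-square = hypotenuse-square r ∣ u ∣ ∣ v ∣ supp
      (ℤ.+-injective (trans (ℤ.pos-+ (∣ u ∣ ℕ.* ∣ u ∣) (∣ v ∣ ℕ.* ∣ v ∣)) (trans (cong₂ ℤ._+_ (abs-square u) (abs-square v)) u²+v²≡r²)))
      2∣r+∣u∣
    pick : + ∣ u ∣ ≡ u ⊎ + ∣ u ∣ ≡ ℤ.- u → IsSquare ps x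
    pick (inj₁ eq) = square-cancel {y = e + e} n (begin
      (e + e) * (e + e)
        ≡⟨ solve 2 (λ e f → (e :+ e) :* (e :+ e) := con (ℤ→ℚ (+ 2)) :* ((e :* e :+ f :* f) :+ (e :* e :- f :* f))) refl e f ⟩
      mℤ (+ 2) * ((e * e + f * f) + (e * e - f * f))
        ≡⟨ cong (mℤ (+ 2) *_) (cong₂ _+_ norm re) ⟩
      mℤ (+ 2) * (x * mℤ (+ r) + x * mℤ u)
        ≡⟨ solve 4 (λ x t r u → t :* (x :* r :+ x :* u) := x :* (t :* (r :+ u))) refl x (mℤ (+ 2)) (mℤ (+ r)) (mℤ u) ⟩
      x * (mℤ (+ 2) * (mℤ (+ r) + mℤ u))
        ≡⟨ cong (x *_) (trans (cong (λ u → mℤ (+ 2) * (mℤ (+ r) + mℤ u)) (sym eq)) (sym mn≡)) ⟩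
      x * mℤ (+ n) ∎) n-square
    pick (inj₂ eq) = square-cancel {y = f + f} n (begin
      (f + f) * (f + f)
        ≡⟨ solve 2 (λ e f → (f :+ f) :* (f :+ f) := con (ℤ→ℚ (+ 2)) :* ((e :* e :+ f :* f) :- (e :* e :- f :* f))) refl e f ⟩
      mℤ (+ 2) * ((e * e + f * f) - (e * e - f * f))
        ≡⟨ cong (mℤ (+ 2) *_) (cong₂ _-_ norm re) ⟩
      mℤ (+ 2) * (x * mℤ (+ r) - x * mℤ u)
        ≡⟨ solve 4 (λ x t r u → t :* (x :* r :- x :* u) := x :* (t :* (r :+ :- u))) refl x (mℤ (+ 2)) (mℤ (+ r)) (mℤ u) ⟩
      x * (mℤ (+ 2) * (mℤ (+ r) + - mℤ u))
        ≡⟨ cong (λ y → x * (mℤ (+ 2) * (mℤ (+ r) + y))) (sym (trans (cong mℤ eq) (trans (cong (mconst ps) (ℤ→ℚ-neg u)) (mconst-neg ps (ℤ→ℚ u))))) ⟩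
      x * (mℤ (+ 2) * (mℤ (+ r) + mℤ (+ ∣ u ∣)))
        ≡⟨ cong (x *_) (sym mn≡) ⟩
      x * mℤ (+ n) ∎) n-square

open import Data.Nat using (_<_; _*_)
open import Data.Rational using (-_)

theorem6p1 : (k : ℕ) (m : Fin k → ℕ)
    → (∀ i → 1 < m i)
    → (∀ i → SquareFree (m i))
    → (ε : Fin k → QF)
    → (∀ i → IsFundamentalUnit (m i) (ε i))
    → (∀ i → qnorm (m i) (ε i) ≡ - 1ℚ)
    → (∃[ r ] prodℕ k m ≡ r * r)
    → (ps : List ℕ)
    → All Prime ps
    → Unique ps
    → (∀ p → Prime p → (p ∣ prodℕ k m ⇔ p ∈ ps))
    → ∃[ y ] mmul ps y y ≡ mprod ps k (λ i → embed ps (m i) (ε i))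
theorem6p1 k m m>1 sf ε fund norm (r , ∏≡r²) ps primes unique prime⇔∈ =
  let u , v , root , u²+v²≡∏ , v-even = product-root ps k m (λ i → embed ps (m i) (ε i)) λ i →
        unit-root ps (m i) {{m≢0 i}} (ε i) primes unique (sf i) (supp i) (fund i) (norm i)
  in root⇒square ps r u v {{r≢0}}
       (λ q q-prime q∣r → to q q-prime (subst (q ∣_) (sym ∏≡r²) (∣m⇒∣m*n r q∣r)))
       -- The hypothesis on ∏ mᵢ enters: the product of the formal √mᵢ becomes the integer r.
       (subst (λ ρ → GaussianRoot ps _ ρ (mℤ ps u) (mℤ ps v)) (mprod-msqrt-square ps primes unique k m m≢0 sf supp r ∏≡r²) root)
       (trans u²+v²≡∏ (cong +_ ∏≡r²))
       -- If 2 is not listed, ∏ mᵢ = r² is odd, which settles the parities of V and of r.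
       (λ 2∉ps → v-even (2∉ps ∘ to 2 prime[2]))
       (λ 2∉ps 2∣r → 2∉ps (to 2 prime[2] (subst (2 ∣_) (sym ∏≡r²) (∣m⇒∣m*n r 2∣r))))
  where
  to : SupportedOn ps (prodℕ k m)
  to q q-prime = Equivalence.to (prime⇔∈ q q-prime)
  m≢0 : ∀ i → NonZero (m i)
  m≢0 i = ℕ.>-nonZero (ℕ.<-trans (ℕ.s≤s ℕ.z≤n) (m>1 i))
  supp : ∀ i → SupportedOn ps (m i)
  supp i q q-prime q∣m = to q q-prime (∣-trans q∣m (factor∣prodℕ k m i))
  r≢0 : NonZero r
  r≢0 = ℕ.m*n≢0⇒m≢0 r {{subst NonZero ∏≡r² (prodℕ-nonZero k m m≢0)}}
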